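{- Consider a universe $\mathcal{U}$ of keys, where $|\mathcal{U}|$ is assumed to be a sufficiently large polynomial in $n$. If a dereference table with $n$ slots and keys from $\mathcal{U}$ supports fixed-sized tiny pointers of size $s$ bits and load factor $1-\delta=\Omega(1)$, then $s=\Omega(\log\log\log n+\log\delta^{ -1})$.
   Context: Dereference tables. A dereference table with $q$-bit values is a data structure supporting: $\mathrm{Create}(n,q)$, which creates a table with an array of $n$ slots of $q$ bits each, called the store; $\mathrm{Allocate}(k)$, which, given a key $k$, allocates a slot of the store to $k$ and returns a bit string $p$ called a tiny pointer; $\mathrm{Dereference}(k,p)$, which returns the index of the slot allocated to $k$ if $p$ is the tiny pointer returned by the most recent call $\mathrm{Allocate}(k)$ (and may return an arbitrary index if $p$ is not valid for $k$); and $\mathrm{Free}(k,p)$, called only on valid pairs, which deallocates slot $\mathrm{Dereference}(k,p)$. Each key holds at most one allocation at a time: after $\mathrm{Allocate}(k)$ returns $p$, $\mathrm{Free}(k,p)$ must be called before $\mathrm{Allocate}(k)$ is called again. A key is present if it has been allocated more recently than freed. Guarantees: for distinct present keys $k_1\ne k_2$ with tiny pointers $p_1,p_2$, $\mathrm{Dereference}(k_1,p_1)\neq \mathrm{Dereference}(k_2,p_2)$; and $\mathrm{Dereference}(k,p)$ depends only on $k$, $p$, random bits, and $n$. Load factor $1-\delta$ means the table supports up to $(1-\delta)n$ simultaneous allocations. Each allocation (made when fewer than $(1-\delta)n$ allocations are live) may fail with probability at most $1/\mathrm{poly}(n)$. The sequence of operations is chosen by an oblivious adversary (fixed in advance, independently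 of the table's random bits). "Fixed-sized tiny pointers of size $s$" means that every tiny pointer returned has size at most $s$ bits.
   Formalization: The formal theorem also assumes δ ≥ n^{ -d} for an arbitrary fixed constant d; without a polynomial lower bound on δ the claim fails (for δ = 2^{ -n}, pointers of O(log n) bits suffice). δ is taken rational and the random bits are fair coin flips. -}

module Defs where

open import Data.Bool.Base using (Bool)
open import Data.Fin.Base using (Fin; toℕ)
open import Data.Fin.Subset using (Subset; ⊥; ⁅_⁆; _∪_; _-_; _∈_; _∉_; ∣_∣)
open import Data.Integer.Base as ℤ using (ℤ; +_)
open import Data.List.Base using (List; []; _∷_; length)
import Data.List.Membership.Propositional as List
open import Data.Maybe.Base using (Maybe; just; nothing)
open import Data.Nat.Base as ℕ using (ℕ; _^_)
open import Data.Nat.Logarithm using (⌈log₂_⌉)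
open import Data.Nat.Properties using (m^n≢0)
open import Data.Product.Base using (Σ-syntax; _×_; _,_; proj₁; proj₂)
open import Data.Rational as ℚ using (ℚ; 1ℚ; Positive; 1/_; ceiling)
open import Data.Rational.Properties using (pos⇒nonZero)
open import Data.Vec.Base using (Vec; tabulate)
open import Data.Vec.Functional using (Vector; updateAt)
open import Function.Base using (const)
open import Relation.Binary.PropositionalEquality using (_≡_; _≢_)

fromℕ : ℕ → ℚ
fromℕ n = + n ℚ./ 1

log₂⌈1/_⌉ : (δ : ℚ) → .{{_ : Positive δ}} → ℕ
log₂⌈1/ δ ⌉ = ⌈log₂ ℤ.∣ ceiling ((1/ δ) {{pos⇒nonZero δ}}) ∣ ⌉

Tape : Set
Tape = ℕ → Bool

prefix : (m : ℕ) → Tape → Vec Bool m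
prefix m ω = tabulate (λ i → ω (toℕ i))

-- Probability over an infinite sequence of independent fair bits, as an outer
-- measure: E is contained in a finite union of cylinders of total measure at
-- most p.  For an event decided by finitely many bits this says exactly that
-- its probability is at most p.
Pr[_]≤_ : (Tape → Set) → ℚ → Set
Pr[ E ]≤ p =
  Σ[ m ∈ ℕ ] Σ[ A ∈ List (Vec Bool m) ]
    (∀ ω → E ω → prefix m ω List.∈ A) ×
    ((+ length A ℚ./ (2 ^ m)) {{m^n≢0 2 m}} ℚ.≤ p)

Pointer : Set
Pointer = List Bool

-- The universe of keys is Fin u and the store has slots Fin n.  The type of
-- dereference makes it a function of the key, the pointer and the random bits
-- only.  An allocation returns nothing when it fails.
record Table (n u : ℕ) : Set₁ where
  field
    State       : Set
    create      : Tape → State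
    allocate    : Tape → State → Fin u → State × Maybe Pointer
    dereference : Tape → Fin u → Pointer → Fin n
    free        : Tape → State → Fin u → Pointer → State

data Op (u : ℕ) : Set where
  alloc dealloc : Fin u → Op u

-- Most recent operation first.  A history does not mention the tape: this is
-- the obliviousness of the adversary.
History : ℕ → Set
History u = List (Op u)

-- The keys present if no allocation fails; in general a superset of the keys
-- present.
scheduled : ∀ {u} → History u → Subset u
scheduled []              = ⊥
scheduled (alloc k ∷ h)   = ⁅ k ⁆ ∪ scheduled h
scheduled (dealloc k ∷ h) = scheduled h - k

data Legal (n : ℕ) (δ : ℚ) {u : ℕ} : History u → Set where
  start   : Legal n δ []
  alloc   : ∀ {h k} → Legal n δ h → k ∉ scheduled h →
            fromℕ ∣ scheduled h ∣ ℚ.< (1ℚ ℚ.- δ) ℚ.* fromℕ n →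
            Legal n δ (alloc k ∷ h)
  dealloc : ∀ {h k} → Legal n δ h → k ∈ scheduled h →
            Legal n δ (dealloc k ∷ h)

module _ {n u : ℕ} (T : Table n u) where
  open Table T

  -- The state of the table, and the valid tiny pointer of every present key.
  Config : Set
  Config = State × Vector (Maybe Pointer) u

  step : Tape → Op u → Config → Config
  step ω (alloc k) (σ , held) with allocate ω σ k
  ... | σ′ , r = σ′ , updateAt held k (const r)
  -- If the scheduled allocation of k failed, there is nothing to free.
  step ω (dealloc k) (σ , held) with held k
  ... | nothing = σ , held
  ... | just p  = free ω σ k p , updateAt held k (const nothing)

  run : Tape → History u → Config
  run ω []      = create ω , const nothing
  run ω (o ∷ h) = step ω o (run ω h)

  state : Tape → History u → State
  state ω h = proj₁ (run ω h)

  pointer : Tape → History u → Fin u → Maybe Pointer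
  pointer ω h = proj₂ (run ω h)

  Fails : History u → Fin u → Tape → Set
  Fails h k ω = proj₂ (allocate ω (state ω h) k) ≡ nothing

  -- T is a dereference table with load factor 1 - δ, each of whose allocations
  -- fails with probability at most ε.
  record IsDereferenceTable (δ ε : ℚ) : Set where
    field
      distinct : ∀ {h} → Legal n δ h → ∀ ω {k₁ k₂ p₁ p₂} → k₁ ≢ k₂ →
                 pointer ω h k₁ ≡ just p₁ → pointer ω h k₂ ≡ just p₂ →
                 dereference ω k₁ p₁ ≢ dereference ω k₂ p₂
      failure  : ∀ {h k} → Legal n δ (alloc k ∷ h) → Pr[ Fails h k ]≤ ε

  FixedSize : ℚ → ℕ → Set
  FixedSize δ s = ∀ {h} → Legal n δ h → ∀ ω {k p} →
                  pointer ω h k ≡ just p → length p ℕ.≤ s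

{-# OPTIONS --safe #-}
-- Averaging over the tape fixes one tape for which random histories see few
-- failures, so it suffices to bound a deterministic online allocator in which
-- every key has a list of D = 2^(s+1) - 1 possible slots.
--
-- For log log log n, insert random keys in D + 1 phases and let q_j be the
-- expected fraction of keys with at least j occupied slots after j phases.
-- During phase j a fraction q_j of the inserted keys has at most D - j vacant
-- slots; each of them occupies one of these, and all but half of them avoid
-- the slots that few such keys have.  Hence q_(j+1) is at least of order
-- q_j² / D² by the Cauchy-Schwarz inequality, unless failures are frequent,
-- and thus q_j ≥ θ^(-2^j) for some θ of order D².  As q_(D+1) = 0, the failure
-- probability must be at least θ^(-2^(D+1)).
--
-- For log δ⁻¹, fill the table, free a random block of R ≈ n / 32D keys and
-- insert R random keys.  At least half of the slots freed are light, which
-- means that a random key has them with probability O(D/n); so most of them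
-- are not even hit, and R is at most of order δn plus the number of failures.
module Submission where

open import Defs
import Algebra.Properties.Semiring.Sum as Sum
open import Data.Bool.Base using (Bool; true; false; not; _∧_)
open import Data.Fin.Base as Fin using (Fin; zero; suc)
import Data.Fin.Properties as Fin
open import Data.Fin.Subset using (Subset; ⁅_⁆; _∪_; _∈_; _∉_; ∣_∣)
open import Data.Fin.Subset.Properties
open import Data.Integer.Base as ℤ using (+_; -[1+_]; +[1+_])
import Data.Integer.DivMod as ℤ
import Data.Integer.Properties as ℤ
open import Data.List.Base as List using (List; []; _∷_; length; _++_; lookup)
import Data.List.Membership.Propositional as List
import Data.List.Membership.Propositional.Properties as List
open import Data.List.Properties using (length-++; length-map; length-tabulate)
open import Data.List.Relation.Unary.All.Properties using (All¬⇒¬Any)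
open import Data.List.Relation.Unary.AllPairs using (_∷_)
open import Data.List.Relation.Unary.Any using (here; there; index; any?)
open import Data.List.Relation.Unary.Any.Properties using (lookup-index)
open import Data.List.Relation.Unary.Unique.Propositional using (Unique)
open import Data.List.Relation.Unary.Unique.Propositional.Properties using (tabulate⁺)
open import Data.Maybe.Base as Maybe using (Maybe; just; nothing)
import Data.Maybe.Properties as Maybe
open import Data.Nat.Base hiding (∣_-_∣)
open import Data.Nat.DivMod using (m≡m%n+[m/n]*n; m%n<n; m/n*n≤m)
open import Data.Nat.Logarithm using (⌈log₂_⌉; ⌈log₂⌉-mono-≤; ⌈log₂2^n⌉≡n)
open import Data.Nat.Properties
open import Data.Nat.Tactic.RingSolver using (solve-∀)
open import Data.Product.Base using (_×_; _,_; ∃; ∃-syntax; proj₁; proj₂)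
open import Data.Rational as ℚ using (ℚ; 1ℚ; 0ℚ; mkℚ; Positive; toℚᵘ)
import Data.Rational.Properties as ℚ
open import Data.Rational.Unnormalised.Base as ℚᵘ using (mkℚᵘ; _≃_)
import Data.Rational.Unnormalised.Properties as ℚᵘ
open import Data.Sum.Base using (_⊎_; inj₁; inj₂; map₁)
open import Data.Unit.Base using (⊤; tt)
open import Data.Vec.Base as Vec using (Vec; []; _∷_)
open import Data.Vec.Functional.Properties using (updateAt-updates; updateAt-minimal)
open import Data.Vec.Properties using ([]=⇒lookup)
open import Function.Base using (_∘_; const)
open import Relation.Binary.PropositionalEquality
open import Relation.Nullary using (Dec; yes; no; does; contradiction; ¬_)
open import Relation.Nullary.Decidable using (_×-dec_; ¬?; dec-true; dec-false)

-- Finite sums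

-- All averages over keys are kept as sums over the `u ^ L` key sequences, with denominators
-- cleared. A random key may already be scheduled; that insertion is skipped and charged as a
-- failure. With at most n keys scheduled and u at least n², the chance of this is at most 1/n, so
-- with g the minimum of n and the inverse failure probability a random insertion costs at most 2/g
-- on average. Whether a key is skipped does not depend on the tape, so these costs add up over all
-- sequences and one tape serves them all. The allocator sees the state and may steer keys to slots
-- that help little. Each drift argument therefore uses a potential that rewards filling useful
-- slots and also rewards failures, so that an insertion can avoid a gain only through a slot that
-- few keys have. In churning, the allocator may have arranged that a freed block consists of
-- popular slots; disjoint blocks are averaged, and a popular slot is charged to only one of them.
-- Churning says nothing when g is at most of order D. But n is at most a power of g, so n is then
-- polynomial in D, and δ ≥ n^(-d) already bounds log δ⁻¹ by a multiple of s.

private module ∑ℕ = Sum +-*-semiring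

⟦_⟧ : Bool → ℕ
⟦ true ⟧  = 1
⟦ false ⟧ = 0

⟦_⟧≤1 : ∀ b → ⟦ b ⟧ ≤ 1
⟦ true ⟧≤1  = ≤-refl
⟦ false ⟧≤1 = z≤n

infixl 10 ∑
syntax ∑ n (λ i → x) = ∑[ i < n ] x

-- Abstract, so that unification can read off the summand.
abstract
  ∑ : ∀ n → (Fin n → ℕ) → ℕ
  ∑ n f = ∑ℕ.sum f

  ∑-cong : ∀ {n} {f g : Fin n → ℕ} → (∀ i → f i ≡ g i) → ∑ n f ≡ ∑ n g
  ∑-cong = ∑ℕ.sum-cong-≗

  ∑-+ : ∀ {n} (f g : Fin n → ℕ) → ∑[ i < n ] (f i + g i) ≡ ∑ n f + ∑ n g
  ∑-+ = ∑ℕ.∑-distrib-+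

  ∑-*ˡ : ∀ {n} c (f : Fin n → ℕ) → ∑[ i < n ] (c * f i) ≡ c * ∑ n f
  ∑-*ˡ c f = sym (∑ℕ.*-distribˡ-sum c f)

  ∑-*ʳ : ∀ {n} (f : Fin n → ℕ) c → ∑[ i < n ] (f i * c) ≡ ∑ n f * c
  ∑-*ʳ f c = sym (∑ℕ.*-distribʳ-sum c f)

  ∑-swap : ∀ {m n} (f : Fin m → Fin n → ℕ) →
           ∑[ i < m ] ∑[ j < n ] f i j ≡ ∑[ j < n ] ∑[ i < m ] f i j
  ∑-swap = ∑ℕ.∑-comm

  ∑-mono : ∀ {n} {f g : Fin n → ℕ} → (∀ i → f i ≤ g i) → ∑ n f ≤ ∑ n g
  ∑-mono {zero}  f≤g = z≤n
  ∑-mono {suc n} f≤g = +-mono-≤ (f≤g zero) (∑-mono {n} (f≤g ∘ suc))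

  ∑-const : ∀ n c → ∑[ i < n ] c ≡ n * c
  ∑-const zero    c = refl
  ∑-const (suc n) c = cong (λ z → c + z) (∑-const n c)

  term≤∑ : ∀ {n} (f : Fin n → ℕ) i → f i ≤ ∑ n f
  term≤∑ f zero    = m≤m+n _ _
  term≤∑ f (suc i) = ≤-trans (term≤∑ (f ∘ suc) i) (m≤n+m _ _)

  ∑-mono-at : ∀ {n} {f g : Fin n → ℕ} i {c} → (∀ j → f j ≤ g j) → f i + c ≤ g i →
              ∑ n f + c ≤ ∑ n g
  ∑-mono-at {suc n} {f} {g} zero {c} f≤g h = begin
    f zero + ∑ n (f ∘ suc) + c   ≡⟨ +-assoc (f zero) _ c ⟩
    f zero + (∑ n (f ∘ suc) + c) ≡⟨ cong (λ z → f zero + z) (+-comm _ c) ⟩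
    f zero + (c + ∑ n (f ∘ suc)) ≡⟨ +-assoc (f zero) c _ ⟨
    f zero + c + ∑ n (f ∘ suc)   ≤⟨ +-mono-≤ h (∑-mono (f≤g ∘ suc)) ⟩
    g zero + ∑ n (g ∘ suc)       ∎
    where open ≤-Reasoning
  ∑-mono-at {suc n} {f} {g} (suc i) {c} f≤g h = begin
    f zero + ∑ n (f ∘ suc) + c   ≡⟨ +-assoc (f zero) _ c ⟩
    f zero + (∑ n (f ∘ suc) + c) ≤⟨ +-mono-≤ (f≤g zero) (∑-mono-at i (f≤g ∘ suc) h) ⟩
    g zero + ∑ n (g ∘ suc)       ∎
    where open ≤-Reasoning

  ∑≢0⇒term≢0 : ∀ {n} (f : Fin n → ℕ) → ∑ n f ≢ 0 → ∃ λ i → f i ≢ 0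
  ∑≢0⇒term≢0 {zero}  f h = contradiction refl h
  ∑≢0⇒term≢0 {suc n} f h with f zero ≟ 0
  ... | no  p = zero , p
  ... | yes p with ∑≢0⇒term≢0 (f ∘ suc) (λ q → h (cong₂ _+_ p q))
  ...   | i , q = suc i , q

  ∑-≤-unique : ∀ {n} (f : Fin n → ℕ) {c} → (∀ i → f i ≤ c) →
               (∀ i j → f i ≢ 0 → f j ≢ 0 → i ≡ j) → ∑ n f ≤ c
  ∑-≤-unique {zero}  f f≤c uniq = z≤n
  ∑-≤-unique {suc n} f {c} f≤c uniq with f zero ≟ 0
  ... | yes p = subst (λ z → z + ∑ n (f ∘ suc) ≤ c) (sym p)
                  (∑-≤-unique (f ∘ suc) (f≤c ∘ suc) λ i j p q →
                    Fin.suc-injective (uniq (suc i) (suc j) p q))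
  ... | no  p with ∑ n (f ∘ suc) ≟ 0
  ...   | yes q = ≤-trans (≤-reflexive (trans (cong (λ z → f zero + z) q) (+-identityʳ _))) (f≤c zero)
  ...   | no  q with ∑≢0⇒term≢0 (f ∘ suc) q
  ...     | i , r with uniq zero (suc i) p r
  ...       | ()

abstract
  ∑-lookup : ∀ {n} (p : Subset n) → ∑[ k < n ] ⟦ Vec.lookup p k ⟧ ≡ ∣ p ∣
  ∑-lookup []          = refl
  ∑-lookup (true ∷ p)  = cong suc (∑-lookup p)
  ∑-lookup (false ∷ p) = ∑-lookup p

∑-≤-const : ∀ {n c} {f : Fin n → ℕ} → (∀ i → f i ≤ c) → ∑ n f ≤ n * c
∑-≤-const {n} {c} f≤c = ≤-trans (∑-mono f≤c) (≤-reflexive (∑-const n c))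

const-≤-∑ : ∀ {n c} {f : Fin n → ℕ} → (∀ i → c ≤ f i) → n * c ≤ ∑ n f
const-≤-∑ {n} {c} c≤f = ≤-trans (≤-reflexive (sym (∑-const n c))) (∑-mono c≤f)

2ab≤a²+b² : ∀ a b → 2 * (a * b) ≤ a * a + b * b
2ab≤a²+b² a b with ≤-total a b
... | inj₁ a≤b = subst (λ z → 2 * (a * z) ≤ a * a + z * z) (m+[n∸m]≡n a≤b) (helper a (b ∸ a))
  where
  helper : ∀ a d → 2 * (a * (a + d)) ≤ a * a + (a + d) * (a + d)
  helper a d = ≤-trans (m≤m+n _ (d * d)) (≤-reflexive (eq a d))
    where
    eq : ∀ a d → 2 * (a * (a + d)) + d * d ≡ a * a + (a + d) * (a + d)
    eq = solve-∀
... | inj₂ b≤a = subst (λ z → 2 * (z * b) ≤ z * z + b * b) (m+[n∸m]≡n b≤a) (helper b (a ∸ b))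
  where
  helper : ∀ b d → 2 * ((b + d) * b) ≤ (b + d) * (b + d) + b * b
  helper b d = ≤-trans (m≤m+n _ (d * d)) (≤-reflexive (eq b d))
    where
    eq : ∀ b d → 2 * ((b + d) * b) + d * d ≡ (b + d) * (b + d) + b * b
    eq = solve-∀

∑-cauchy-schwarz : ∀ {n} (f : Fin n → ℕ) → ∑ n f * ∑ n f ≤ n * ∑[ i < n ] (f i * f i)
∑-cauchy-schwarz {n} f = *-cancelˡ-≤ 2 (begin
  2 * (∑ n f * ∑ n f)                           ≡⟨ cong (2 *_) (∑-*ʳ f (∑ n f)) ⟨
  2 * ∑[ i < n ] (f i * ∑ n f)                  ≡⟨ ∑-*ˡ 2 _ ⟨
  ∑[ i < n ] (2 * (f i * ∑ n f))                ≡⟨ ∑-cong (λ i → trans (cong (2 *_) (sym (∑-*ˡ (f i) f))) (sym (∑-*ˡ 2 _))) ⟩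
  ∑[ i < n ] ∑[ j < n ] (2 * (f i * f j))       ≤⟨ ∑-mono (λ i → ∑-mono λ j → 2ab≤a²+b² (f i) (f j)) ⟩
  ∑[ i < n ] ∑[ j < n ] (f i * f i + f j * f j) ≡⟨ ∑-cong (λ i → trans (∑-+ _ _) (cong (_+ s) (∑-const n _))) ⟩
  ∑[ i < n ] (n * (f i * f i) + s)              ≡⟨ ∑-+ _ _ ⟩
  ∑[ i < n ] (n * (f i * f i)) + ∑[ i < n ] s   ≡⟨ cong₂ _+_ (∑-*ˡ n _) (∑-const n s) ⟩
  n * s + n * s                                 ≡⟨ cong (λ z → n * s + z) (+-identityʳ (n * s)) ⟨
  2 * (n * s)                                   ∎)
  where
  open ≤-Reasoning
  s = ∑[ i < n ] (f i * f i)

-- A view of `𝟙[_]`: abstracting the number and its view together splits a sum's term on the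
-- decision. `𝟙[_]` is abstract so that it stays visible to such a `with`.
data Indicator {p} (P : Set p) : ℕ → Set p where
  holds : P → Indicator P 1
  fails : ¬ P → Indicator P 0

abstract
  𝟙[_] : ∀ {p} {P : Set p} → Dec P → ℕ
  𝟙[ P? ] = ⟦ does P? ⟧

  indicator : ∀ {p} {P : Set p} (P? : Dec P) → Indicator P 𝟙[ P? ]
  indicator (yes p) = holds p
  indicator (no ¬p) = fails ¬p

𝟙[_]≤1 : ∀ {p} {P : Set p} (P? : Dec P) → 𝟙[ P? ] ≤ 1
𝟙[ P? ]≤1 with 𝟙[ P? ] | indicator P?
... | _ | holds _ = ≤-refl
... | _ | fails _ = z≤n

-- Random walks and online allocation

module Walk {X : Set} {u : ℕ} (ins : Fin u → X → X) where

  -- This is `u ^ L` times the expectation of `g` after `L` independent uniform insertions,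
  -- repetitions allowed.
  𝕊 : ℕ → (X → ℕ) → X → ℕ
  𝕊 zero    g x = g x
  𝕊 (suc L) g x = ∑[ k < u ] 𝕊 L g (ins k x)

  𝕊-mono : ∀ L {g h : X → ℕ} → (∀ x → g x ≤ h x) → ∀ x → 𝕊 L g x ≤ 𝕊 L h x
  𝕊-mono zero    g≤h x = g≤h x
  𝕊-mono (suc L) g≤h x = ∑-mono λ k → 𝕊-mono L g≤h (ins k x)

  𝕊-+ : ∀ L (g h : X → ℕ) x → 𝕊 L (λ x → g x + h x) x ≡ 𝕊 L g x + 𝕊 L h x
  𝕊-+ zero    g h x = refl
  𝕊-+ (suc L) g h x = trans (∑-cong λ k → 𝕊-+ L g h (ins k x)) (∑-+ _ _)

  𝕊-*ˡ : ∀ L c (g : X → ℕ) x → 𝕊 L (λ x → c * g x) x ≡ c * 𝕊 L g x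
  𝕊-*ˡ zero    c g x = refl
  𝕊-*ˡ (suc L) c g x = trans (∑-cong λ k → 𝕊-*ˡ L c g (ins k x)) (∑-*ˡ c _)

  𝕊-const : ∀ L c x → 𝕊 L (λ _ → c) x ≡ u ^ L * c
  𝕊-const zero    c x = sym (*-identityˡ c)
  𝕊-const (suc L) c x = trans (∑-cong λ k → 𝕊-const L c (ins k x))
    (trans (∑-const u _) (sym (*-assoc u (u ^ L) c)))

  𝕊-compose : ∀ t L (g : X → ℕ) x → 𝕊 (t + L) g x ≡ 𝕊 t (𝕊 L g) x
  𝕊-compose zero    L g x = refl
  𝕊-compose (suc t) L g x = ∑-cong λ k → 𝕊-compose t L g (ins k x)

  𝕊-cauchy-schwarz : ∀ L (g : X → ℕ) x →
                     𝕊 L g x * 𝕊 L g x ≤ u ^ L * 𝕊 L (λ x → g x * g x) x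
  𝕊-cauchy-schwarz zero    g x = ≤-reflexive (sym (*-identityˡ _))
  𝕊-cauchy-schwarz (suc L) g x = begin
    𝕊 (suc L) g x * 𝕊 (suc L) g x
      ≤⟨ ∑-cauchy-schwarz (λ k → 𝕊 L g (ins k x)) ⟩
    u * ∑[ k < u ] (𝕊 L g (ins k x) * 𝕊 L g (ins k x))
      ≤⟨ *-monoʳ-≤ u (∑-mono λ k → 𝕊-cauchy-schwarz L g (ins k x)) ⟩
    u * ∑[ k < u ] (u ^ L * 𝕊 L (λ x → g x * g x) (ins k x))
      ≡⟨ cong (u *_) (∑-*ˡ (u ^ L) _) ⟩
    u * (u ^ L * 𝕊 (suc L) (λ x → g x * g x) x)
      ≡⟨ *-assoc u (u ^ L) _ ⟨
    u ^ suc L * 𝕊 (suc L) (λ x → g x * g x) x ∎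
    where open ≤-Reasoning

  -- A submartingale bound: each step raises `Ψ` by at least `e / u` on average. `Ψ′` takes over at
  -- the end of the walk, because the comparison may need the invariant `I`, which the final sum no
  -- longer mentions.
  𝕊-drift : (I : X → Set) (Ψ Ψ′ : X → ℕ) (e : ℕ) →
            (∀ k {x} → I x → I (ins k x)) →
            (∀ {x} → I x → Ψ x ≤ Ψ′ x) →
            (∀ {x} → I x → u * Ψ x + e ≤ ∑[ k < u ] Ψ (ins k x)) →
            ∀ L {x} → I x → u ^ L * (u * Ψ x + L * e) ≤ u * 𝕊 L Ψ′ x
  𝕊-drift I Ψ Ψ′ e I-ins Ψ≤Ψ′ step = go
    where
    open ≤-Reasoning
    rearrange : ∀ a b c d e → a * b * (a * c + (e + d * e)) ≡ b * (a * (a * c + e) + a * (d * e))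
    rearrange = solve-∀
    go : ∀ L {x} → I x → u ^ L * (u * Ψ x + L * e) ≤ u * 𝕊 L Ψ′ x
    go zero    {x} i = begin
      1 * (u * Ψ x + 0) ≡⟨ trans (*-identityˡ _) (+-identityʳ _) ⟩
      u * Ψ x           ≤⟨ *-monoʳ-≤ u (Ψ≤Ψ′ i) ⟩
      u * Ψ′ x          ∎
    go (suc L) {x} i = begin
      u * u ^ L * (u * Ψ x + (e + L * e))
        ≡⟨ rearrange u (u ^ L) (Ψ x) L e ⟩
      u ^ L * (u * (u * Ψ x + e) + u * (L * e))
        ≤⟨ *-monoʳ-≤ (u ^ L) (+-monoˡ-≤ (u * (L * e)) (*-monoʳ-≤ u (step i))) ⟩
      u ^ L * (u * ∑[ k < u ] Ψ (ins k x) + u * (L * e))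
        ≡⟨ cong (u ^ L *_) (cong₂ _+_ (∑-*ˡ u _) (∑-const u (L * e))) ⟨
      u ^ L * (∑[ k < u ] (u * Ψ (ins k x)) + ∑[ k < u ] (L * e))
        ≡⟨ cong (u ^ L *_) (∑-+ _ _) ⟨
      u ^ L * ∑[ k < u ] (u * Ψ (ins k x) + L * e)
        ≡⟨ ∑-*ˡ (u ^ L) _ ⟨
      ∑[ k < u ] (u ^ L * (u * Ψ (ins k x) + L * e))
        ≤⟨ ∑-mono (λ k → go L (I-ins k i)) ⟩
      ∑[ k < u ] (u * 𝕊 L Ψ′ (ins k x))
        ≡⟨ ∑-*ˡ u _ ⟩
      u * 𝕊 (suc L) Ψ′ x ∎

  -- The opposite estimate, for an increment of at most `e` on average. `room` carries the number of
  -- steps still to come, since the estimate is available only while capacity remains.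
  𝕊-growth : (room : X → ℕ → Set) (p : X → ℕ) (e : ℕ) →
             (∀ k {x L} → room x (suc L) → room (ins k x) L) →
             (∀ {x L} → room x (suc L) → ∑[ k < u ] p (ins k x) ≤ u * (p x + e)) →
             ∀ L {x} → room x L → 𝕊 L p x ≤ u ^ L * (p x + L * e)
  𝕊-growth room p e room-ins step = go
    where
    open ≤-Reasoning
    rearrange : ∀ a b c d e → b * (a * (c + e) + a * (d * e)) ≡ a * b * (c + (e + d * e))
    rearrange = solve-∀
    go : ∀ L {x} → room x L → 𝕊 L p x ≤ u ^ L * (p x + L * e)
    go zero    {x} r = ≤-reflexive (sym (trans (*-identityˡ _) (+-identityʳ _)))
    go (suc L) {x} r = begin
      ∑[ k < u ] 𝕊 L p (ins k x)
        ≤⟨ ∑-mono (λ k → go L (room-ins k r)) ⟩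
      ∑[ k < u ] (u ^ L * (p (ins k x) + L * e))
        ≡⟨ trans (∑-*ˡ (u ^ L) _) (cong (u ^ L *_) (trans (∑-+ _ _) (cong (λ z → ∑ u (λ k → p (ins k x)) + z) (∑-const u _)))) ⟩
      u ^ L * (∑[ k < u ] p (ins k x) + u * (L * e))
        ≤⟨ *-monoʳ-≤ (u ^ L) (+-monoˡ-≤ (u * (L * e)) (step r)) ⟩
      u ^ L * (u * (p x + e) + u * (L * e))
        ≡⟨ rearrange u (u ^ L) (p x) L e ⟩
      u ^ suc L * (p x + suc L * e) ∎

δ : ∀ {n} → Fin n → Fin n → ℕ
δ x y = 𝟙[ x Fin.≟ y ]

∑-δ : ∀ {n} (f : Fin n → ℕ) x → ∑[ y < n ] (f y * δ x y) ≡ f x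
∑-δ {n} f x = ≤-antisym (∑-≤-unique _ bound unique)
  (≤-trans (≤-reflexive (at x refl)) (term≤∑ (λ y → f y * δ x y) x))
  where
  at : ∀ y → x ≡ y → f x ≡ f y * δ x y
  at y x≡y with 𝟙[ x Fin.≟ y ] | indicator (x Fin.≟ y)
  ... | _ | holds refl = sym (*-identityʳ _)
  ... | _ | fails x≢y  = contradiction x≡y x≢y
  off : ∀ y → f y * δ x y ≢ 0 → x ≡ y
  off y h with 𝟙[ x Fin.≟ y ] | indicator (x Fin.≟ y)
  ... | _ | holds x≡y = x≡y
  ... | _ | fails _   = contradiction (*-zeroʳ (f y)) h
  bound : ∀ y → f y * δ x y ≤ f x
  bound y with 𝟙[ x Fin.≟ y ] | indicator (x Fin.≟ y)
  ... | _ | holds refl = ≤-reflexive (*-identityʳ _)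
  ... | _ | fails _    = ≤-trans (≤-reflexive (*-zeroʳ (f y))) z≤n
  unique : ∀ y z → f y * δ x y ≢ 0 → f z * δ x z ≢ 0 → y ≡ z
  unique y z p q = trans (sym (off y p)) (off z q)

-- The cost is at least the number of insertions that have failed so far.
record Process (n u D : ℕ) : Set₁ where
  field
    X        : Set
    ins      : Fin u → X → X
    full     : X → Fin n → Bool
    cost     : X → ℕ
    slot     : Fin u → Fin D → Fin n
    full-ins : ∀ k x y → full x y ≡ true → full (ins k x) y ≡ true
    cost-ins : ∀ k x → cost x ≤ cost (ins k x)
    place    : ∀ k x → suc (cost x) ≤ cost (ins k x) ⊎
               ∃ λ i → full x (slot k i) ≡ false × full (ins k x) (slot k i) ≡ true

module ProcessProperties {n u D} (P : Process n u D) where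
  open Process P
  open Walk ins
  open ≤-Reasoning

  value : (Fin n → ℕ) → X → ℕ
  value v x = ∑[ y < n ] (⟦ full x y ⟧ * v y)

  weight : (Fin u → ℕ) → Fin n → ℕ
  weight f y = ∑[ k < u ] ∑[ i < D ] (f k * δ (slot k i) y)

  -- Double counting of the pairs of a key and one of its choices, grouped by slot or by key.
  ∑-weight : ∀ (v : Fin n → ℕ) (f : Fin u → ℕ) →
             ∑[ y < n ] (v y * weight f y) ≡ ∑[ k < u ] (f k * ∑[ i < D ] v (slot k i))
  ∑-weight v f = begin-equality
    ∑[ y < n ] (v y * weight f y)
      ≡⟨ ∑-cong (λ y → trans (sym (∑-*ˡ (v y) _)) (∑-cong λ k → sym (∑-*ˡ (v y) _))) ⟩
    ∑[ y < n ] ∑[ k < u ] ∑[ i < D ] (v y * (f k * δ (slot k i) y))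
      ≡⟨ ∑-swap _ ⟩
    ∑[ k < u ] ∑[ y < n ] ∑[ i < D ] (v y * (f k * δ (slot k i) y))
      ≡⟨ ∑-cong (λ k → ∑-swap _) ⟩
    ∑[ k < u ] ∑[ i < D ] ∑[ y < n ] (v y * (f k * δ (slot k i) y))
      ≡⟨ ∑-cong (λ k → ∑-cong λ i → trans (∑-cong λ y → shuffle (v y) (f k) (δ (slot k i) y)) (∑-*ˡ (f k) _)) ⟩
    ∑[ k < u ] ∑[ i < D ] (f k * ∑[ y < n ] (v y * δ (slot k i) y))
      ≡⟨ ∑-cong (λ k → trans (∑-cong λ i → cong (f k *_) (∑-δ v (slot k i))) (∑-*ˡ (f k) _)) ⟩
    ∑[ k < u ] (f k * ∑[ i < D ] v (slot k i)) ∎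
    where
    shuffle : ∀ a b c → a * (b * c) ≡ b * (a * c)
    shuffle = solve-∀

  full-mono : ∀ k x y → ⟦ full x y ⟧ ≤ ⟦ full (ins k x) y ⟧
  full-mono k x y with full x y | full-ins k x y
  ... | false | _ = z≤n
  ... | true  | h rewrite h refl = ≤-refl

  value-mono : ∀ v k x → value v x ≤ value v (ins k x)
  value-mono v k x = ∑-mono λ y → *-monoˡ-≤ (v y) (full-mono k x y)

  -- An insertion raises the cost, or it fills a slot worth t, or the key has
  -- a choice that is bad.
  value-ins : ∀ (v bad : Fin n → ℕ) {t c} k x → t ≤ c →
              (∀ y → full x y ≡ false → t ≤ v y + t * bad y) →
              value v x + c * cost x + t ≤
              value v (ins k x) + c * cost (ins k x) + t * ∑[ i < D ] bad (slot k i)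
  value-ins v bad {t} {c} k x t≤c worth with place k x
  ... | inj₁ more = begin
    value v x + c * cost x + t     ≡⟨ +-assoc (value v x) _ t ⟩
    value v x + (c * cost x + t)   ≤⟨ +-mono-≤ (value-mono v k x) (+-monoʳ-≤ (c * cost x) t≤c) ⟩
    value v x′ + (c * cost x + c)  ≡⟨ cong (λ z → value v x′ + z) (trans (+-comm (c * cost x) c) (sym (*-suc c (cost x)))) ⟩
    value v x′ + c * suc (cost x)  ≤⟨ +-monoʳ-≤ (value v x′) (*-monoʳ-≤ c more) ⟩
    value v x′ + c * cost x′       ≤⟨ m≤m+n _ _ ⟩
    value v x′ + c * cost x′ + t * ∑[ i < D ] bad (slot k i) ∎
    where x′ = ins k x
  ... | inj₂ (i , empty , filled) = begin
    value v x + c * cost x + t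
      ≤⟨ +-mono-≤ (+-monoʳ-≤ (value v x) (*-monoʳ-≤ c (cost-ins k x))) (worth y empty) ⟩
    value v x + c * cost x′ + (v y + t * bad y)
      ≡⟨ shuffle (value v x) (c * cost x′) (v y) (t * bad y) ⟩
    value v x + v y + c * cost x′ + t * bad y
      ≤⟨ +-mono-≤ (+-monoˡ-≤ (c * cost x′) gain) (*-monoʳ-≤ t (term≤∑ (λ i → bad (slot k i)) i)) ⟩
    value v x′ + c * cost x′ + t * ∑[ i < D ] bad (slot k i) ∎
    where
    x′ = ins k x
    y = slot k i
    shuffle : ∀ a b c d → a + b + (c + d) ≡ a + c + b + d
    shuffle = solve-∀
    gain : value v x + v y ≤ value v x′
    gain = ∑-mono-at y (λ z → *-monoˡ-≤ (v z) (full-mono k x z))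
      (≤-reflexive (subst₂ (λ a b → ⟦ a ⟧ * v y + v y ≡ ⟦ b ⟧ * v y) (sym empty) (sym filled) (sym (+-identityʳ _))))

  vacant : X → Fin u → ℕ
  vacant x k = ∑[ i < D ] ⟦ not (full x (slot k i)) ⟧

  -- Stated through vacancies, so that no key is crowded at level `suc D`. Choices are counted with
  -- multiplicity: equal slots in the list of a key count separately.
  crowded : ℕ → X → Fin u → ℕ
  crowded j x k = 𝟙[ vacant x k + j ≤? D ]

  #crowded : ℕ → X → ℕ
  #crowded j x = ∑ u (crowded j x)

  module Phase .{{_ : NonZero n}} (j : ℕ) (x₀ : X) where

    c : ℕ
    c = #crowded j x₀

    -- A slot is bad if fewer than `c / 2n` choices of crowded keys lead to it, so the n slots
    -- together carry less than half of `c` in bad weight. The factor `4 * n` makes every other slot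
    -- that was vacant at `x₀` worth at least `2 * c`.
    w bad v : Fin n → ℕ
    w     = weight (crowded j x₀)
    bad y = 𝟙[ 2 * n * w y <? c ]
    v y   = 4 * n * (⟦ not (full x₀ y) ⟧ * w y)

    -- A failure is rewarded with `2 * u`, which is at least the `2 * c` earned by a good placement.
    -- Thus neither outcome lets a crowded key escape the gain.
    Ψ Ψ′ : X → ℕ
    Ψ  x = value v x + 2 * u * cost x
    Ψ′ x = 4 * n * D * #crowded (suc j) x + 2 * u * cost x

    Later : X → Set
    Later x = ∀ y → full x₀ y ≡ true → full x y ≡ true

    c≤u : c ≤ u
    c≤u = ≤-trans (∑-≤-const λ k → 𝟙[ _ ]≤1) (≤-reflexive (*-identityʳ u))

    bad-weight : 2 * ∑[ y < n ] (bad y * w y) ≤ c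
    bad-weight = *-cancelˡ-≤ n (begin
      n * (2 * ∑[ y < n ] (bad y * w y))  ≡⟨ *-assoc n 2 _ ⟨
      n * 2 * ∑[ y < n ] (bad y * w y)    ≡⟨ cong (_* ∑ n (λ y → bad y * w y)) (*-comm n 2) ⟩
      2 * n * ∑[ y < n ] (bad y * w y)    ≡⟨ ∑-*ˡ (2 * n) _ ⟨
      ∑[ y < n ] (2 * n * (bad y * w y))  ≤⟨ ∑-≤-const small ⟩
      n * c                               ∎)
      where
      small : ∀ y → 2 * n * (bad y * w y) ≤ c
      small y with bad y | indicator (2 * n * w y <? c)
      ... | _ | holds light = ≤-trans (≤-reflexive (cong (2 * n *_) (*-identityˡ (w y)))) (<⇒≤ light)
      ... | _ | fails _     = ≤-trans (≤-reflexive (*-zeroʳ (2 * n))) z≤n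

    worth : ∀ {x} k → Later x → ∀ y → full x y ≡ false →
            2 * c * crowded j x₀ k ≤ v y + 2 * c * crowded j x₀ k * bad y
    worth k later y empty with full x₀ y in eq
    ... | true  = contradiction (trans (sym (later y eq)) empty) λ ()
    ... | false with bad y | indicator (2 * n * w y <? c)
    ...   | _ | holds _     = ≤-trans (≤-reflexive (sym (*-identityʳ _))) (m≤n+m _ (4 * n * (1 * w y)))
    ...   | _ | fails heavy = begin
      2 * c * crowded j x₀ k ≤⟨ *-monoʳ-≤ (2 * c) 𝟙[ _ ]≤1 ⟩
      2 * c * 1              ≡⟨ *-identityʳ (2 * c) ⟩
      2 * c                  ≤⟨ *-monoʳ-≤ 2 (≮⇒≥ heavy) ⟩
      2 * (2 * n * w y)      ≡⟨ shuffle n (w y) ⟩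
      4 * n * (1 * w y)      ≤⟨ m≤m+n _ _ ⟩
      4 * n * (1 * w y) + 2 * c * crowded j x₀ k * 0 ∎
      where
      shuffle : ∀ n w → 2 * (2 * n * w) ≡ 4 * n * (1 * w)
      shuffle = solve-∀

    -- The `c` crowded keys gain `2 * c` each, in total `2 * c * c`; bad choices take back at most
    -- `2 * c` times the bad weight, hence at most `c * c`.
    drift : ∀ {x} → Later x → u * Ψ x + c * c ≤ ∑[ k < u ] Ψ (ins k x)
    drift {x} later = +-cancelʳ-≤ (c * c) _ _ (begin
      u * Ψ x + c * c + c * c
        ≡⟨ shuffle (u * Ψ x) c ⟩
      u * Ψ x + 2 * c * c
        ≡⟨ cong₂ _+_ (∑-const u (Ψ x)) (∑-*ˡ (2 * c) (crowded j x₀)) ⟨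
      ∑[ k < u ] Ψ x + ∑[ k < u ] (2 * c * crowded j x₀ k)
        ≡⟨ ∑-+ _ _ ⟨
      ∑[ k < u ] (Ψ x + 2 * c * crowded j x₀ k)
        ≤⟨ ∑-mono (λ k → value-ins v bad k x (t≤2u k) (worth k later)) ⟩
      ∑[ k < u ] (Ψ (ins k x) + 2 * c * crowded j x₀ k * ∑[ i < D ] bad (slot k i))
        ≡⟨ ∑-+ _ _ ⟩
      ∑[ k < u ] Ψ (ins k x) + ∑[ k < u ] (2 * c * crowded j x₀ k * ∑[ i < D ] bad (slot k i))
        ≡⟨ cong (λ z → ∑ u (λ k → Ψ (ins k x)) + z) (trans (∑-cong λ k → *-assoc (2 * c) _ _)
             (trans (∑-*ˡ (2 * c) _) (cong (2 * c *_) (sym (∑-weight bad (crowded j x₀)))))) ⟩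
      ∑[ k < u ] Ψ (ins k x) + 2 * c * ∑[ y < n ] (bad y * w y)
        ≤⟨ +-monoʳ-≤ _ (≤-trans (≤-reflexive (shuffle′ c _)) (*-monoʳ-≤ c bad-weight)) ⟩
      ∑[ k < u ] Ψ (ins k x) + c * c ∎)
      where
      shuffle : ∀ a c → a + c * c + c * c ≡ a + 2 * c * c
      shuffle = solve-∀
      shuffle′ : ∀ c s → 2 * c * s ≡ c * (2 * s)
      shuffle′ = solve-∀
      t≤2u : ∀ k → 2 * c * crowded j x₀ k ≤ 2 * u
      t≤2u k = ≤-trans (*-mono-≤ (*-monoʳ-≤ 2 c≤u) 𝟙[ _ ]≤1) (≤-reflexive (*-identityʳ (2 * u)))

    -- Only slots filled since `x₀` have value. A crowded key contributes at most `D` of them, and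
    -- if it contributes any, it has reached the next level of crowding.
    Ψ≤Ψ′ : ∀ {x} → Later x → Ψ x ≤ Ψ′ x
    Ψ≤Ψ′ {x} later = +-monoˡ-≤ (2 * u * cost x) (begin
      value v x
        ≡⟨ ∑-cong (λ y → shuffle n ⟦ full x y ⟧ ⟦ not (full x₀ y) ⟧ (w y)) ⟩
      ∑[ y < n ] (4 * n * (new y * w y))
        ≡⟨ trans (∑-*ˡ (4 * n) _) (cong (4 * n *_) (∑-weight new (crowded j x₀))) ⟩
      4 * n * ∑[ k < u ] (crowded j x₀ k * ∑[ i < D ] new (slot k i))
        ≤⟨ *-monoʳ-≤ (4 * n) (∑-mono hit) ⟩
      4 * n * ∑[ k < u ] (D * crowded (suc j) x k)
        ≡⟨ cong (4 * n *_) (∑-*ˡ D _) ⟩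
      4 * n * (D * #crowded (suc j) x)
        ≡⟨ *-assoc (4 * n) D _ ⟨
      4 * n * D * #crowded (suc j) x ∎)
      where
      new : Fin n → ℕ
      new y = ⟦ full x y ⟧ * ⟦ not (full x₀ y) ⟧
      shuffle : ∀ n a b w → a * (4 * n * (b * w)) ≡ 4 * n * (a * b * w)
      shuffle = solve-∀
      new≤1 : ∀ y → new y ≤ 1
      new≤1 y = *-mono-≤ ⟦ full x y ⟧≤1 ⟦ not (full x₀ y) ⟧≤1
      split : ∀ y → ⟦ not (full x y) ⟧ + new y ≤ ⟦ not (full x₀ y) ⟧
      split y with full x₀ y | later y
      ... | true  | h rewrite h refl = z≤n
      ... | false | _ with full x y
      ...   | true  = ≤-refl
      ...   | false = ≤-refl
      vacant-drop : ∀ k → vacant x k + ∑[ i < D ] new (slot k i) ≤ vacant x₀ k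
      vacant-drop k = ≤-trans (≤-reflexive (sym (∑-+ _ _))) (∑-mono λ i → split (slot k i))
      hit : ∀ k → crowded j x₀ k * ∑[ i < D ] new (slot k i) ≤ D * crowded (suc j) x k
      hit k with crowded j x₀ k | indicator (vacant x₀ k + j ≤? D)
      ... | _ | fails _ = z≤n
      ... | _ | holds p with ∑[ i < D ] new (slot k i) | vacant-drop k | ∑-≤-const {c = 1} (λ i → new≤1 (slot k i))
      ...   | zero  | _ | _ = z≤n
      ...   | suc m | q | r with crowded (suc j) x k | indicator (vacant x k + suc j ≤? D)
      ...     | _ | holds _ = ≤-trans (≤-reflexive (*-identityˡ (suc m))) (≤-trans r ≤-refl)
      ...     | _ | fails ¬p = contradiction (begin
        vacant x k + suc j       ≡⟨ +-assoc (vacant x k) 1 j ⟨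
        vacant x k + 1 + j       ≤⟨ +-monoˡ-≤ j (≤-trans (+-monoʳ-≤ (vacant x k) (s≤s z≤n)) q) ⟩
        vacant x₀ k + j          ≤⟨ p ⟩
        D                        ∎) ¬p

    phase : ∀ L → u ^ L * (L * (c * c)) ≤ u * 𝕊 L Ψ′ x₀
    phase L = ≤-trans (*-monoʳ-≤ (u ^ L) (m≤n+m _ (u * Ψ x₀)))
      (𝕊-drift Later Ψ Ψ′ (c * c) (λ k later y p → full-ins k _ y (later y p)) Ψ≤Ψ′ drift L (λ _ p → p))

-- Crowding

-- The recurrence q′ ≥ q² / (16aPD), for the normalised counts q = Q / (uU)
-- and q′ = Q′ / (uUW) and with q ≥ 1/b.
recurrence : ∀ {a b D F g L n P Q Q′ u U W : ℕ} →
             .{{_ : NonZero L}} → .{{_ : NonZero P}} → .{{_ : NonZero u}} → .{{_ : NonZero U}} →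
             W * (L * (Q * Q)) ≤ U * (u * (4 * n * D * Q′ + 2 * u * F)) →
             u * U ≤ b * Q → g * F ≤ 2 * (P * L) * (U * W) → 8 * P * (b * b) ≤ g →
             n ≤ 2 * a * P * L → u * (U * W) ≤ 16 * a * P * D * (b * b) * Q′
recurrence {a} {b} {D} {F} {g} {L} {n} {P} {Q} {Q′} {u} {U} {W} phase low fail small short =
  *-cancelˡ-≤ L (begin
    L * (u * (U * W))                        ≤⟨ +-cancelʳ-≤ (L * (u * (U * W))) _ _ doubled ⟩
    8 * (b * b) * n * D * Q′                 ≤⟨ *-monoˡ-≤ Q′ (*-monoˡ-≤ D (*-monoʳ-≤ (8 * (b * b)) short)) ⟩
    8 * (b * b) * (2 * a * P * L) * D * Q′   ≡⟨ eq₅ a b D L P Q′ ⟩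
    L * (16 * a * P * D * (b * b) * Q′)      ∎)
  where
  open ≤-Reasoning
  eq₁ : ∀ b F P → 2 * P * (4 * (b * b) * F) ≡ 8 * P * (b * b) * F
  eq₁ = solve-∀
  eq₂ : ∀ L P U W → 2 * (P * L) * (U * W) ≡ 2 * P * (L * (U * W))
  eq₂ = solve-∀
  eq₃ : ∀ L W u U → u * U * (L * (u * (U * W))) ≡ W * (L * (u * U * (u * U)))
  eq₃ = solve-∀
  eq₃′ : ∀ L W b Q → W * (L * (b * Q * (b * Q))) ≡ b * b * (W * (L * (Q * Q)))
  eq₃′ = solve-∀
  eq₃″ : ∀ b u U Y → b * b * (U * (u * Y)) ≡ u * U * (b * b * Y)
  eq₃″ = solve-∀
  eq₄ : ∀ b n D Q′ u F → 2 * (b * b * (4 * n * D * Q′ + 2 * u * F)) ≡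
        8 * (b * b) * n * D * Q′ + u * (4 * (b * b) * F)
  eq₄ = solve-∀
  eq₄′ : ∀ L u V → u * (L * V) ≡ L * (u * V)
  eq₄′ = solve-∀
  eq₅ : ∀ a b D L P Q′ → 8 * (b * b) * (2 * a * P * L) * D * Q′ ≡ L * (16 * a * P * D * (b * b) * Q′)
  eq₅ = solve-∀
  -- The failure term uses up one of the two copies of `L * (u * (U * W))` in `doubled`, which
  -- leaves the other for `Q′`.
  failures : 4 * (b * b) * F ≤ L * (U * W)
  failures = *-cancelˡ-≤ (2 * P) {{m*n≢0 2 P}} (begin
    2 * P * (4 * (b * b) * F)  ≡⟨ eq₁ b F P ⟩
    8 * P * (b * b) * F        ≤⟨ *-monoˡ-≤ F small ⟩
    g * F                      ≤⟨ fail ⟩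
    2 * (P * L) * (U * W)      ≡⟨ eq₂ L P U W ⟩
    2 * P * (L * (U * W))      ∎)
  squared : L * (u * (U * W)) ≤ b * b * (4 * n * D * Q′ + 2 * u * F)
  squared = *-cancelˡ-≤ (u * U) {{m*n≢0 u U}} (begin
    u * U * (L * (u * (U * W)))                         ≡⟨ eq₃ L W u U ⟩
    W * (L * (u * U * (u * U)))                         ≤⟨ *-monoʳ-≤ W (*-monoʳ-≤ L (*-mono-≤ low low)) ⟩
    W * (L * (b * Q * (b * Q)))                         ≡⟨ eq₃′ L W b Q ⟩
    b * b * (W * (L * (Q * Q)))                         ≤⟨ *-monoʳ-≤ (b * b) phase ⟩
    b * b * (U * (u * (4 * n * D * Q′ + 2 * u * F)))    ≡⟨ eq₃″ b u U _ ⟩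
    u * U * (b * b * (4 * n * D * Q′ + 2 * u * F))      ∎)
  doubled : L * (u * (U * W)) + L * (u * (U * W)) ≤ 8 * (b * b) * n * D * Q′ + L * (u * (U * W))
  doubled = begin
    L * (u * (U * W)) + L * (u * (U * W))                ≡⟨ cong (λ z → L * (u * (U * W)) + z) (+-identityʳ _) ⟨
    2 * (L * (u * (U * W)))                              ≤⟨ *-monoʳ-≤ 2 squared ⟩
    2 * (b * b * (4 * n * D * Q′ + 2 * u * F))           ≡⟨ eq₄ b n D Q′ u F ⟩
    8 * (b * b) * n * D * Q′ + u * (4 * (b * b) * F)     ≤⟨ +-monoʳ-≤ _ (*-monoʳ-≤ u failures) ⟩
    8 * (b * b) * n * D * Q′ + u * (L * (U * W))         ≡⟨ cong (λ z → 8 * (b * b) * n * D * Q′ + z) (eq₄′ L u (U * W)) ⟩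
    8 * (b * b) * n * D * Q′ + L * (u * (U * W))         ∎

module Collapse {n u D} (Pr : Process n u D) .{{_ : NonZero n}} .{{_ : NonZero u}} .{{_ : NonZero D}} where
  open Process Pr
  open ProcessProperties Pr
  open Walk ins
  open ≤-Reasoning

  cost-𝕊 : ∀ L x → u ^ L * cost x ≤ 𝕊 L cost x
  cost-𝕊 zero    x = ≤-reflexive (*-identityˡ _)
  cost-𝕊 (suc L) x = begin
    u * u ^ L * cost x            ≡⟨ *-assoc u (u ^ L) (cost x) ⟩
    u * (u ^ L * cost x)          ≤⟨ const-≤-∑ (λ k → ≤-trans (*-monoʳ-≤ (u ^ L) (cost-ins k x)) (cost-𝕊 L (ins k x))) ⟩
    ∑[ k < u ] 𝕊 L cost (ins k x) ∎

  -- `phase` is applied at every state reached after `t` insertions. Its gain is quadratic in the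
  -- number of crowded keys, so Cauchy-Schwarz allows the mean number to be used instead.
  average-phase : ∀ j t L x →
    u ^ L * (L * (𝕊 t (#crowded j) x * 𝕊 t (#crowded j) x)) ≤
    u ^ t * (u * (4 * n * D * 𝕊 (t + L) (#crowded (suc j)) x + 2 * u * 𝕊 (t + L) cost x))
  average-phase j t L x = begin
    W * (L * (𝕊 t (#crowded j) x * 𝕊 t (#crowded j) x))
      ≤⟨ *-monoʳ-≤ W (*-monoʳ-≤ L (𝕊-cauchy-schwarz t (#crowded j) x)) ⟩
    W * (L * (u ^ t * S²))
      ≡⟨ shuffle W L (u ^ t) S² ⟩
    u ^ t * (W * (L * S²))
      ≡⟨ cong (u ^ t *_) (trans (cong (W *_) (sym (𝕊-*ˡ t L _ x))) (sym (𝕊-*ˡ t W _ x))) ⟩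
    u ^ t * 𝕊 t (λ y → W * (L * (#crowded j y * #crowded j y))) x
      ≤⟨ *-monoʳ-≤ (u ^ t) (𝕊-mono t (λ y → Phase.phase j y L) x) ⟩
    u ^ t * 𝕊 t (λ y → u * 𝕊 L Ψ′ y) x
      ≡⟨ cong (u ^ t *_) (trans (𝕊-*ˡ t u _ x) (cong (u *_) (sym (𝕊-compose t L Ψ′ x)))) ⟩
    u ^ t * (u * 𝕊 (t + L) Ψ′ x)
      ≡⟨ cong (λ z → u ^ t * (u * z)) (trans (𝕊-+ (t + L) (λ y → 4 * n * D * #crowded (suc j) y) (λ y → 2 * u * cost y) x)
           (cong₂ _+_ (𝕊-*ˡ (t + L) (4 * n * D) (#crowded (suc j)) x) (𝕊-*ˡ (t + L) (2 * u) cost x))) ⟩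
    u ^ t * (u * (4 * n * D * 𝕊 (t + L) (#crowded (suc j)) x + 2 * u * 𝕊 (t + L) cost x)) ∎
    where
    W = u ^ L
    S² = 𝕊 t (λ y → #crowded j y * #crowded j y) x
    Ψ′ : X → ℕ
    Ψ′ y = 4 * n * D * #crowded (suc j) y + 2 * u * cost y
    shuffle : ∀ a b c d → a * (b * (c * d)) ≡ c * (a * (b * d))
    shuffle = solve-∀

  module _ (a g L : ℕ) (x : X) .{{_ : NonZero a}} .{{_ : NonZero L}} where

    P θ : ℕ
    P = suc D
    θ = 16 * a * P * D

    -- `1 / b j` is the lower bound for the mean fraction of keys crowded at level `j`; the squaring
    -- comes from `recurrence`.
    b : ℕ → ℕ
    b zero    = 1
    b (suc j) = θ * (b j * b j)

    θ*b : ∀ j → θ * b j ≡ θ ^ (2 ^ j)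
    θ*b zero    = refl
    θ*b (suc j) = begin-equality
      θ * (θ * (b j * b j))       ≡⟨ shuffle θ (b j) ⟩
      θ * b j * (θ * b j)         ≡⟨ cong₂ _*_ (θ*b j) (θ*b j) ⟩
      θ ^ (2 ^ j) * θ ^ (2 ^ j)   ≡⟨ ^-distribˡ-+-* θ (2 ^ j) (2 ^ j) ⟨
      θ ^ (2 ^ j + 2 ^ j)         ≡⟨ cong (λ z → θ ^ (2 ^ j + z)) (+-identityʳ (2 ^ j)) ⟨
      θ ^ (2 ^ suc j)             ∎
      where
      shuffle : ∀ t b → t * (t * (b * b)) ≡ t * b * (t * b)
      shuffle = solve-∀

    8P≤θ : 8 * P ≤ θ
    8P≤θ = begin
      8 * P              ≤⟨ m≤m*n (8 * P) (2 * a * D) {{m*n≢0 (2 * a) D {{m*n≢0 2 a}}}} ⟩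
      8 * P * (2 * a * D) ≡⟨ shuffle a P D ⟩
      θ                  ∎
      where
      shuffle : ∀ a P D → 8 * P * (2 * a * D) ≡ 16 * a * P * D
      shuffle = solve-∀

    instance
      θ≢0 : NonZero θ
      θ≢0 = >-nonZero (≤-trans (s≤s z≤n) 8P≤θ)

    b-small : θ ^ (2 ^ P) ≤ g → ∀ {j} → j < P → 8 * P * (b j * b j) ≤ g
    b-small θ≤g {j} j<P = begin
      8 * P * (b j * b j)  ≤⟨ *-monoˡ-≤ (b j * b j) 8P≤θ ⟩
      b (suc j)            ≤⟨ m≤n*m (b (suc j)) θ ⟩
      θ * b (suc j)        ≡⟨ θ*b (suc j) ⟩
      θ ^ (2 ^ suc j)      ≤⟨ ^-monoʳ-≤ θ (^-monoʳ-≤ 2 j<P) ⟩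
      θ ^ (2 ^ P)          ≤⟨ θ≤g ⟩
      g                    ∎

    -- Costs never decrease along a walk, so the mean cost at an earlier time is within the budget
    -- `C` of the whole walk.
    cheap-prefix : ∀ {C} t t′ → g * 𝕊 (t + t′) cost x ≤ C * u ^ (t + t′) → g * 𝕊 t cost x ≤ C * u ^ t
    cheap-prefix {C} t t′ cheap = *-cancelˡ-≤ (u ^ t′) {{m^n≢0 u t′}} (begin
      u ^ t′ * (g * 𝕊 t cost x)              ≡⟨ shuffle (u ^ t′) g _ ⟩
      g * (u ^ t′ * 𝕊 t cost x)              ≡⟨ cong (g *_) (𝕊-*ˡ t (u ^ t′) cost x) ⟨
      g * 𝕊 t (λ y → u ^ t′ * cost y) x      ≤⟨ *-monoʳ-≤ g (𝕊-mono t (cost-𝕊 t′) x) ⟩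
      g * 𝕊 t (𝕊 t′ cost) x                  ≡⟨ cong (g *_) (𝕊-compose t t′ cost x) ⟨
      g * 𝕊 (t + t′) cost x                  ≤⟨ cheap ⟩
      C * u ^ (t + t′)                       ≡⟨ trans (cong (C *_) (^-distribˡ-+-* u t t′)) (shuffle′ C (u ^ t) (u ^ t′)) ⟩
      u ^ t′ * (C * u ^ t)                   ∎)
      where
      shuffle : ∀ a b c → a * (b * c) ≡ b * (a * c)
      shuffle = solve-∀
      shuffle′ : ∀ a b c → a * (b * c) ≡ c * (a * b)
      shuffle′ = solve-∀

    module _ (short : n ≤ 2 * a * P * L)
             (cheap : g * 𝕊 (P * L) cost x ≤ 2 * (P * L) * u ^ (P * L)) where

      cheap-at : ∀ {t} → t ≤ P * L → g * 𝕊 t cost x ≤ 2 * (P * L) * u ^ t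
      cheap-at {t} t≤ = cheap-prefix {C = 2 * (P * L)} t (P * L ∸ t)
        (subst (λ z → g * 𝕊 z cost x ≤ 2 * (P * L) * u ^ z) (sym (m+[n∸m]≡n t≤)) cheap)

      crowding : θ ^ (2 ^ P) ≤ g → ∀ j → j ≤ P → u * u ^ (j * L) ≤ b j * 𝕊 (j * L) (#crowded j) x
      crowding θ≤g zero j≤P = begin
        u * 1                       ≤⟨ const-≤-∑ everything ⟩
        #crowded 0 x                ≡⟨ *-identityˡ _ ⟨
        1 * 𝕊 0 (#crowded 0) x      ∎
        where
        everything : ∀ k → 1 ≤ crowded 0 x k
        everything k with crowded 0 x k | indicator (vacant x k + 0 ≤? D)
        ... | _ | holds _ = ≤-refl
        ... | _ | fails h = contradiction
          (≤-trans (≤-reflexive (+-identityʳ _)) (≤-trans (∑-≤-const λ i → ⟦ _ ⟧≤1) (≤-reflexive (*-identityʳ D)))) h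
      crowding θ≤g (suc j) j<P = subst (λ t → u * u ^ t ≤ b (suc j) * 𝕊 t (#crowded (suc j)) x) (+-comm (j * L) L)
        (begin
          u * u ^ (j * L + L)                           ≡⟨ cong (u *_) (^-distribˡ-+-* u (j * L) L) ⟩
          u * (u ^ (j * L) * u ^ L)                     ≤⟨ recurrence {a} {b j} {D} {𝕊 (j * L + L) cost x} {g} {L} {n} {P} {𝕊 (j * L) (#crowded j) x} {_} {u} {u ^ (j * L)}
                                                             (average-phase j (j * L) L x) (crowding θ≤g j (<⇒≤ j<P))
                                                             (≤-trans (cheap-at in-time) (≤-reflexive (cong (2 * (P * L) *_) (^-distribˡ-+-* u (j * L) L))))
                                                             (b-small θ≤g j<P) short ⟩
          b (suc j) * 𝕊 (j * L + L) (#crowded (suc j)) x ∎)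
        where
        instance
          U≢0 : NonZero (u ^ (j * L))
          U≢0 = m^n≢0 u (j * L)
        in-time : j * L + L ≤ P * L
        in-time = ≤-trans (≤-reflexive (+-comm (j * L) L)) (*-monoˡ-≤ L j<P)

      collapse : g < θ ^ (2 ^ P)
      collapse = ≰⇒> λ θ≤g → <⇒≱ (>-nonZero⁻¹ (u * u ^ (P * L)) {{m*n≢0 u (u ^ (P * L))}}) (begin
        u * u ^ (P * L)                   ≤⟨ crowding θ≤g P ≤-refl ⟩
        b P * 𝕊 (P * L) (#crowded P) x    ≤⟨ *-monoʳ-≤ (b P) (𝕊-mono (P * L) none x) ⟩
        b P * 𝕊 (P * L) (λ _ → 0) x       ≡⟨ cong (b P *_) (trans (𝕊-const (P * L) 0 x) (*-zeroʳ (u ^ (P * L)))) ⟩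
        b P * 0                           ≡⟨ *-zeroʳ (b P) ⟩
        0                                 ∎)
        where
        instance
          U≢0 : NonZero (u ^ (P * L))
          U≢0 = m^n≢0 u (P * L)
        none : ∀ y → #crowded P y ≤ 0
        none y = ≤-trans (∑-≤-const zero-at) (≤-reflexive (*-zeroʳ u))
          where
          zero-at : ∀ k → crowded P y k ≤ 0
          zero-at k with crowded P y k | indicator (vacant y k + P ≤? D)
          ... | _ | fails _ = z≤n
          ... | _ | holds h = contradiction (≤-trans (m≤n+m P (vacant y k)) h) 1+n≰n

-- Churning

module Refill {n u D} (Pr : Process n u D) .{{_ : NonZero n}} .{{_ : NonZero u}} .{{_ : NonZero D}} where
  open Process Pr
  open ProcessProperties Pr
  open Walk ins
  open ≤-Reasoning

  w : Fin n → ℕ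
  w = weight λ _ → 1

  #full : X → ℕ
  #full x = ∑[ y < n ] ⟦ full x y ⟧

  #full-ins : ∀ k x → suc (#full x + cost x) ≤ #full (ins k x) + cost (ins k x)
  #full-ins k x = begin
    suc (#full x + cost x)
      ≡⟨ trans (+-comm 1 _) (cong (_+ 1) (cong₂ _+_ (as-value x) (sym (*-identityˡ (cost x))))) ⟩
    value (λ _ → 1) x + 1 * cost x + 1
      ≤⟨ value-ins (λ _ → 1) (λ _ → 0) {1} {1} k x ≤-refl (λ _ _ → s≤s z≤n) ⟩
    value (λ _ → 1) x′ + 1 * cost x′ + 1 * ∑[ i < D ] 0
      ≡⟨ trans (cong (λ z → value (λ _ → 1) x′ + 1 * cost x′ + z) (trans (*-identityˡ _) (trans (∑-const D 0) (*-zeroʳ D)))) (+-identityʳ _) ⟩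
    value (λ _ → 1) x′ + 1 * cost x′
      ≡⟨ cong₂ _+_ (as-value x′) (sym (*-identityˡ (cost x′))) ⟨
    #full x′ + cost x′ ∎
    where
    x′ = ins k x
    as-value : ∀ x → #full x ≡ value (λ _ → 1) x
    as-value x = ∑-cong λ y → sym (*-identityʳ _)

  -- Light slots are rarely hit, so most of the R insertions go elsewhere.
  refill : ∀ R (Z : Fin n → Bool) → 32 * D * R ≤ n → ∑[ y < n ] ⟦ Z y ⟧ ≤ R →
           (∀ y → ⟦ Z y ⟧ * (n * w y) ≤ 8 * D * u) → ∀ x →
           u ^ R * (4 * ∑[ y < n ] (⟦ full x y ⟧ * ⟦ not (Z y) ⟧ + ⟦ Z y ⟧) + 4 * cost x + 3 * R)
             ≤ u ^ R * (4 * n) + 4 * 𝕊 R cost x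
  refill R Z R-small Z≤R light x₀ = *-cancelˡ-≤ u (begin
    u * (u ^ R * (4 * ∑[ y < n ] (⟦ full x₀ y ⟧ * ⟦ not (Z y) ⟧ + ⟦ Z y ⟧) + 4 * cost x₀ + 3 * R))
      ≡⟨ cong (λ z → u * (u ^ R * (z + 4 * cost x₀ + 3 * R))) split ⟩
    u * (u ^ R * (value v x₀ + 4 * #Z + 4 * cost x₀ + 3 * R))
      ≡⟨ shuffle u (u ^ R) (value v x₀) (4 * #Z) (4 * cost x₀) R ⟩
    u ^ R * (u * Ψ x₀ + R * (3 * u))
      ≤⟨ 𝕊-drift (λ _ → ⊤) Ψ Ψ′ (3 * u) (λ _ _ → tt) (λ {x} _ → Ψ≤Ψ′ x) (λ {x} _ → drift x) R tt ⟩
    u * 𝕊 R Ψ′ x₀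
      ≡⟨ cong (u *_) (trans (𝕊-+ R (λ _ → 4 * n) (λ x → 4 * cost x) x₀) (cong₂ _+_ (𝕊-const R (4 * n) x₀) (𝕊-*ˡ R 4 cost x₀))) ⟩
    u * (u ^ R * (4 * n) + 4 * 𝕊 R cost x₀) ∎)
    where
    #Z : ℕ
    #Z = ∑[ y < n ] ⟦ Z y ⟧
    v z : Fin n → ℕ
    v y = 4 * ⟦ not (Z y) ⟧
    z y = ⟦ Z y ⟧
    -- Slots of `Z` are credited as full from the outset and are worthless to an insertion. This
    -- keeps `Ψ` below `4 * n` plus the cost, and only insertions into `Z` fail to raise it.
    Ψ Ψ′ : X → ℕ
    Ψ  x = value v x + 4 * cost x + 4 * #Z
    Ψ′ x = 4 * n + 4 * cost x
    shuffle : ∀ a b c d e r → a * (b * (c + d + e + 3 * r)) ≡ b * (a * (c + e + d) + r * (3 * a))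
    shuffle = solve-∀
    4*-comm : ∀ a b → 4 * (a * b) ≡ a * (4 * b)
    4*-comm = solve-∀
    split : 4 * ∑[ y < n ] (⟦ full x₀ y ⟧ * ⟦ not (Z y) ⟧ + ⟦ Z y ⟧) ≡ value v x₀ + 4 * #Z
    split = begin-equality
      4 * ∑[ y < n ] (⟦ full x₀ y ⟧ * ⟦ not (Z y) ⟧ + ⟦ Z y ⟧)
        ≡⟨ trans (cong (4 *_) (∑-+ (λ y → ⟦ full x₀ y ⟧ * ⟦ not (Z y) ⟧) z)) (*-distribˡ-+ 4 (∑[ y < n ] (⟦ full x₀ y ⟧ * ⟦ not (Z y) ⟧)) #Z) ⟩
      4 * ∑[ y < n ] (⟦ full x₀ y ⟧ * ⟦ not (Z y) ⟧) + 4 * #Z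
        ≡⟨ cong (_+ 4 * #Z) (trans (sym (∑-*ˡ 4 _)) (∑-cong λ y → 4*-comm ⟦ full x₀ y ⟧ ⟦ not (Z y) ⟧)) ⟩
      value v x₀ + 4 * #Z ∎
    Ψ≤Ψ′ : ∀ x → Ψ x ≤ Ψ′ x
    Ψ≤Ψ′ x = begin
      value v x + 4 * cost x + 4 * #Z    ≡⟨ swap (value v x) (4 * cost x) (4 * #Z) ⟩
      value v x + 4 * #Z + 4 * cost x    ≡⟨ cong (λ t → value v x + t + 4 * cost x) (∑-*ˡ 4 z) ⟨
      value v x + ∑[ y < n ] (4 * z y) + 4 * cost x ≡⟨ cong (_+ 4 * cost x) (∑-+ _ _) ⟨
      ∑[ y < n ] (⟦ full x y ⟧ * v y + 4 * z y) + 4 * cost x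
        ≤⟨ +-monoˡ-≤ (4 * cost x) (≤-trans (∑-≤-const at-most-4) (≤-reflexive (*-comm n 4))) ⟩
      4 * n + 4 * cost x ∎
      where
      swap : ∀ a b c → a + b + c ≡ a + c + b
      swap = solve-∀
      at-most-4 : ∀ y → ⟦ full x y ⟧ * v y + 4 * z y ≤ 4
      at-most-4 y with Z y
      ... | true  = ≤-reflexive (cong (_+ 4) (*-zeroʳ ⟦ full x y ⟧))
      ... | false with full x y
      ...   | true  = ≤-refl
      ...   | false = z≤n
    -- At most `R` slots, each with at most `8 * D * u / n` choices leading to it: by
    -- `32 * D * R ≤ n` a random key has on average at most 1/4 choices in `Z`. This leaves the
    -- drift of 3 out of 4.
    hits : 4 * ∑[ k < u ] ∑[ i < D ] z (slot k i) ≤ u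
    hits = *-cancelˡ-≤ n (begin
      n * (4 * ∑[ k < u ] ∑[ i < D ] z (slot k i))
        ≡⟨ cong (λ t → n * (4 * t)) (trans (∑-cong λ k → sym (*-identityˡ _)) (sym (∑-weight z (λ _ → 1)))) ⟩
      n * (4 * ∑[ y < n ] (z y * w y))
        ≡⟨ trans (comm₁ n _) (cong (4 *_) (sym (∑-*ˡ n _))) ⟩
      4 * ∑[ y < n ] (n * (z y * w y))
        ≤⟨ *-monoʳ-≤ 4 (∑-mono rare) ⟩
      4 * ∑[ y < n ] (z y * (8 * D * u))
        ≡⟨ cong (4 *_) (∑-*ʳ z (8 * D * u)) ⟩
      4 * (#Z * (8 * D * u))
        ≤⟨ *-monoʳ-≤ 4 (*-monoˡ-≤ (8 * D * u) Z≤R) ⟩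
      4 * (R * (8 * D * u))
        ≡⟨ comm₂ R D u ⟩
      32 * D * R * u
        ≤⟨ *-monoˡ-≤ u R-small ⟩
      n * u ∎)
      where
      comm₁ : ∀ a b → a * (4 * b) ≡ 4 * (a * b)
      comm₁ = solve-∀
      comm₂ : ∀ r d u → 4 * (r * (8 * d * u)) ≡ 32 * d * r * u
      comm₂ = solve-∀
      rare : ∀ y → n * (z y * w y) ≤ z y * (8 * D * u)
      rare y with Z y | light y
      ... | true  | h = ≤-trans (≤-reflexive (trans (cong (n *_) (*-identityˡ (w y))) (sym (*-identityˡ _)))) (≤-trans h (≤-reflexive (sym (*-identityˡ _))))
      ... | false | _ = ≤-reflexive (*-zeroʳ n)
    drift : ∀ x → u * Ψ x + 3 * u ≤ ∑[ k < u ] Ψ (ins k x)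
    drift x = +-cancelʳ-≤ u _ _ (begin
      u * Ψ x + 3 * u + u
        ≡⟨ collect u (Ψ x) ⟩
      u * (Ψ x + 4)
        ≡⟨ ∑-const u (Ψ x + 4) ⟨
      ∑[ k < u ] (Ψ x + 4)
        ≤⟨ ∑-mono one ⟩
      ∑[ k < u ] (Ψ (ins k x) + 4 * ∑[ i < D ] z (slot k i))
        ≡⟨ trans (∑-+ _ _) (cong (λ z → ∑ u (λ k → Ψ (ins k x)) + z) (∑-*ˡ 4 _)) ⟩
      ∑[ k < u ] Ψ (ins k x) + 4 * ∑[ k < u ] ∑[ i < D ] z (slot k i)
        ≤⟨ +-monoʳ-≤ _ hits ⟩
      ∑[ k < u ] Ψ (ins k x) + u ∎)
      where
      collect : ∀ u a → u * a + 3 * u + u ≡ u * (a + 4)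
      collect = solve-∀
      swap : ∀ a b c → a + b + c ≡ a + c + b
      swap = solve-∀
      worth : ∀ y → 4 ≤ v y + 4 * z y
      worth y with Z y
      ... | true  = ≤-refl
      ... | false = ≤-refl
      one : ∀ k → Ψ x + 4 ≤ Ψ (ins k x) + 4 * ∑[ i < D ] z (slot k i)
      one k = begin
        value v x + 4 * cost x + 4 * #Z + 4      ≡⟨ swap (value v x + 4 * cost x) (4 * #Z) 4 ⟩
        value v x + 4 * cost x + 4 + 4 * #Z      ≤⟨ +-monoˡ-≤ (4 * #Z) (value-ins v z {4} {4} k x ≤-refl λ y _ → worth y) ⟩
        value v (ins k x) + 4 * cost (ins k x) + 4 * ∑[ i < D ] z (slot k i) + 4 * #Z 
          ≡⟨ swap (value v (ins k x) + 4 * cost (ins k x)) (4 * ∑[ i < D ] z (slot k i)) (4 * #Z) ⟩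
        Ψ (ins k x) + 4 * ∑[ i < D ] z (slot k i) ∎

  abstract
    heavy? : ∀ y → Dec (8 * D * u < n * w y)
    heavy? y = 8 * D * u <? n * w y

  heavy : Fin n → ℕ
  heavy y = ⟦ does (heavy? y) ⟧

  -- Markov's inequality: the mean of `w` over the slots is `D * u / n`, and a heavy slot exceeds
  -- eight times that.
  few-heavy : 8 * ∑ n heavy ≤ n
  few-heavy = *-cancelʳ-≤ _ _ (D * u) {{m*n≢0 D u}} (begin
    8 * ∑ n heavy * (D * u)            ≡⟨ shuffle (∑ n heavy) D u ⟩
    ∑ n heavy * (8 * D * u)            ≡⟨ ∑-*ʳ heavy (8 * D * u) ⟨
    ∑[ y < n ] (heavy y * (8 * D * u)) ≤⟨ ∑-mono exceeds ⟩
    ∑[ y < n ] (n * w y)               ≡⟨ trans (∑-*ˡ n w) (cong (n *_) (trans (∑-cong λ y → sym (*-identityˡ (w y))) (∑-weight (λ _ → 1) (λ _ → 1)))) ⟩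
    n * ∑[ k < u ] (1 * ∑[ i < D ] 1)  ≡⟨ cong (n *_) (trans (∑-cong λ k → trans (*-identityˡ _) (trans (∑-const D 1) (*-identityʳ D))) (∑-const u D)) ⟩
    n * (u * D)                        ≡⟨ cong (n *_) (*-comm u D) ⟩
    n * (D * u)                        ∎)
    where
    shuffle : ∀ a d u → 8 * a * (d * u) ≡ a * (8 * d * u)
    shuffle = solve-∀
    exceeds : ∀ y → heavy y * (8 * D * u) ≤ n * w y
    exceeds y with heavy? y
    ... | yes h = ≤-trans (≤-reflexive (*-identityˡ _)) (<⇒≤ h)
    ... | no  _ = z≤n

  module _ {B R M : ℕ} (x₀ : X) (x : Fin B → X) (removed : Fin B → Fin n → ℕ)
           (R-small : 32 * D * R ≤ n)
           (covers  : ∀ b y → ⟦ full x₀ y ⟧ ≤ ⟦ full (x b) y ⟧ + removed b y)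
           (few     : ∀ b → ∑ n (removed b) ≤ R)
           (once    : ∀ y → ∑[ b < B ] removed b y ≤ 1)
           (loaded  : M ≤ #full x₀ + cost x₀)
           (pays    : ∀ b → cost x₀ ≤ cost (x b)) where

    Z : Fin B → Fin n → Bool
    Z b y = not (does (heavy? y)) ∧ (full x₀ y ∧ not (full (x b) y))

    -- A slot full before the block is freed is still full, or light and in `Z b`, or heavy and
    -- removed. The first two kinds are what `refill` counts; the third is kept as an error term.
    churn-block : ∀ b → u ^ R * (4 * M + 3 * R) ≤
                  u ^ R * (4 * n) + 4 * 𝕊 R cost (x b) + u ^ R * (4 * ∑[ y < n ] (heavy y * removed b y))
    churn-block b = begin
      u ^ R * (4 * M + 3 * R)
        ≤⟨ *-monoʳ-≤ (u ^ R) (+-monoˡ-≤ (3 * R) (*-monoʳ-≤ 4 enough)) ⟩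
      u ^ R * (4 * (S + H + cost (x b)) + 3 * R)
        ≡⟨ shuffle (u ^ R) S H (cost (x b)) R ⟩
      u ^ R * (4 * S + 4 * cost (x b) + 3 * R) + u ^ R * (4 * H)
        ≤⟨ +-monoˡ-≤ (u ^ R * (4 * H)) (refill R (Z b) R-small Z≤R light (x b)) ⟩
      u ^ R * (4 * n) + 4 * 𝕊 R cost (x b) + u ^ R * (4 * H) ∎
      where
      S H : ℕ
      S = ∑[ y < n ] (⟦ full (x b) y ⟧ * ⟦ not (Z b y) ⟧ + ⟦ Z b y ⟧)
      H = ∑[ y < n ] (heavy y * removed b y)
      shuffle : ∀ p s h c r → p * (4 * (s + h + c) + 3 * r) ≡ p * (4 * s + 4 * c + 3 * r) + p * (4 * h)
      shuffle = solve-∀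
      light : ∀ y → ⟦ Z b y ⟧ * (n * w y) ≤ 8 * D * u
      light y with heavy? y
      ... | yes _ = z≤n
      ... | no  h with full x₀ y ∧ not (full (x b) y)
      ...   | true  = ≤-trans (≤-reflexive (*-identityˡ _)) (≮⇒≥ h)
      ...   | false = z≤n
      Z≤removed : ∀ y → ⟦ Z b y ⟧ ≤ removed b y
      Z≤removed y with does (heavy? y) | full x₀ y | full (x b) y | covers b y
      ... | true  | _     | _     | _ = z≤n
      ... | false | false | _     | _ = z≤n
      ... | false | true  | true  | _ = z≤n
      ... | false | true  | false | h = h
      Z≤R : ∑[ y < n ] ⟦ Z b y ⟧ ≤ R
      Z≤R = ≤-trans (∑-mono Z≤removed) (few b)
      pointwise : ∀ y → ⟦ full x₀ y ⟧ ≤ ⟦ full (x b) y ⟧ * ⟦ not (Z b y) ⟧ + ⟦ Z b y ⟧ + heavy y * removed b y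
      pointwise y with does (heavy? y) | full x₀ y | full (x b) y | covers b y
      ... | _     | false | _     | _ = z≤n
      ... | false | true  | true  | _ = s≤s z≤n
      ... | true  | true  | true  | _ = s≤s z≤n
      ... | false | true  | false | _ = s≤s z≤n
      ... | true  | true  | false | h = ≤-trans h (≤-reflexive (sym (*-identityˡ _)))
      enough : M ≤ S + H + cost (x b)
      enough = ≤-trans loaded (+-mono-≤ (≤-trans (∑-mono pointwise) (≤-reflexive (∑-+ _ _))) (pays b))

    -- By `once` the heavy error terms of all blocks add up to at most the number of heavy slots, at
    -- most n/8 regardless of `B`, whereas the gain grows with `B * R`.
    churn : u ^ R * (2 * B * (4 * M + 3 * R)) ≤ u ^ R * (8 * n * B + n) + 8 * ∑[ b < B ] 𝕊 R cost (x b)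
    churn = begin
      p * (2 * B * (4 * M + 3 * R))
        ≡⟨ eq₁ p B (4 * M + 3 * R) ⟩
      2 * (B * (p * (4 * M + 3 * R)))
        ≤⟨ *-monoʳ-≤ 2 (const-≤-∑ churn-block) ⟩
      2 * ∑[ b < B ] (p * (4 * n) + 4 * 𝕊 R cost (x b) + p * (4 * ∑[ y < n ] (heavy y * removed b y)))
        ≡⟨ cong (2 *_) (trans (∑-+ _ _) (cong₂ _+_ (trans (∑-+ _ _) (cong₂ _+_ (∑-const B _) (∑-*ˡ 4 _))) (trans (∑-*ˡ p _) (cong (p *_) (∑-*ˡ 4 _))))) ⟩
      2 * (B * (p * (4 * n)) + 4 * C + p * (4 * ∑[ b < B ] ∑[ y < n ] (heavy y * removed b y)))
        ≤⟨ *-monoʳ-≤ 2 (+-monoʳ-≤ (B * (p * (4 * n)) + 4 * C) (*-monoʳ-≤ p (*-monoʳ-≤ 4 heavy-removed))) ⟩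
      2 * (B * (p * (4 * n)) + 4 * C + p * (4 * ∑ n heavy))
        ≡⟨ eq₂ p B n C (∑ n heavy) ⟩
      p * (8 * n * B + 8 * ∑ n heavy) + 8 * C
        ≤⟨ +-monoˡ-≤ (8 * C) (*-monoʳ-≤ p (+-monoʳ-≤ (8 * n * B) few-heavy)) ⟩
      p * (8 * n * B + n) + 8 * C ∎
      where
      p C : ℕ
      p = u ^ R
      C = ∑[ b < B ] 𝕊 R cost (x b)
      eq₁ : ∀ p b m → p * (2 * b * m) ≡ 2 * (b * (p * m))
      eq₁ = solve-∀
      eq₂ : ∀ p b n c h → 2 * (b * (p * (4 * n)) + 4 * c + p * (4 * h)) ≡ p * (8 * n * b + 8 * h) + 8 * c
      eq₂ = solve-∀
      heavy-removed : ∑[ b < B ] ∑[ y < n ] (heavy y * removed b y) ≤ ∑ n heavy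
      heavy-removed = begin
        ∑[ b < B ] ∑[ y < n ] (heavy y * removed b y) ≡⟨ ∑-swap _ ⟩
        ∑[ y < n ] ∑[ b < B ] (heavy y * removed b y) ≡⟨ ∑-cong (λ y → ∑-*ˡ (heavy y) _) ⟩
        ∑[ y < n ] (heavy y * ∑[ b < B ] removed b y) ≤⟨ ∑-mono (λ y → ≤-trans (*-monoʳ-≤ (heavy y) (once y)) (≤-reflexive (*-identityʳ _))) ⟩
        ∑ n heavy                                     ∎

-- Expectation over the tape

cons : Bool → Tape → Tape
cons b ω zero    = b
cons b ω (suc i) = ω i

-- 2 ^ m times the expectation over the first m bits.
𝔼 : ℕ → (Tape → ℕ) → ℕ
𝔼 zero    G = G (const false)
𝔼 (suc m) G = 𝔼 m (G ∘ cons true) + 𝔼 m (G ∘ cons false)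

𝔼-+ : ∀ m G H → 𝔼 m (λ ω → G ω + H ω) ≡ 𝔼 m G + 𝔼 m H
𝔼-+ zero    G H = refl
𝔼-+ (suc m) G H = trans (cong₂ _+_ (𝔼-+ m _ _) (𝔼-+ m _ _)) (shuffle (𝔼 m (G ∘ cons true)) _ (𝔼 m (G ∘ cons false)) _)
  where
  shuffle : ∀ a b c d → a + b + (c + d) ≡ a + c + (b + d)
  shuffle = solve-∀

𝔼-const : ∀ m c → 𝔼 m (const c) ≡ c * 2 ^ m
𝔼-const zero    c = sym (*-identityʳ c)
𝔼-const (suc m) c = trans (cong₂ _+_ (𝔼-const m c) (𝔼-const m c)) (double c (2 ^ m))
  where
  double : ∀ c p → c * p + c * p ≡ c * (2 * p)
  double = solve-∀

𝔼-∑ : ∀ m {n} (G : Fin n → Tape → ℕ) → 𝔼 m (λ ω → ∑[ i < n ] G i ω) ≡ ∑[ i < n ] 𝔼 m (G i)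
𝔼-∑ zero    G = refl
𝔼-∑ (suc m) G = trans (cong₂ _+_ (𝔼-∑ m _) (𝔼-∑ m _)) (sym (∑-+ _ _))

-- Some tape does no worse than the mean: take the better half at each bit. The tape is padded with
-- `false`, as in `𝔼`.
𝔼-attained : ∀ m G → ∃ λ ω → 2 ^ m * G ω ≤ 𝔼 m G
𝔼-attained zero    G = const false , ≤-reflexive (*-identityˡ _)
𝔼-attained (suc m) G with 𝔼-attained m (G ∘ cons true) | 𝔼-attained m (G ∘ cons false)
... | ω , p | ω′ , q with ≤-total (G (cons true ω)) (G (cons false ω′))
...   | inj₁ r = cons true ω , ≤-trans (≤-reflexive (double (2 ^ m) _)) (+-mono-≤ p (≤-trans (*-monoʳ-≤ (2 ^ m) r) q))
  where
  double : ∀ p c → 2 * p * c ≡ p * c + p * c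
  double = solve-∀
...   | inj₂ r = cons false ω′ , ≤-trans (≤-reflexive (double (2 ^ m) _)) (+-mono-≤ (≤-trans (*-monoʳ-≤ (2 ^ m) r) p) q)
  where
  double : ∀ p c → 2 * p * c ≡ p * c + p * c
  double = solve-∀

matches : ∀ {m} → Vec Bool m → Tape → ℕ
matches []          ω = 1
matches (true ∷ v)  ω = ⟦ ω 0 ⟧ * matches v (ω ∘ suc)
matches (false ∷ v) ω = ⟦ not (ω 0) ⟧ * matches v (ω ∘ suc)

matches-prefix : ∀ m ω → matches (prefix m ω) ω ≡ 1
matches-prefix zero    ω = refl
matches-prefix (suc m) ω with ω 0 in eq
... | true  rewrite eq = trans (*-identityˡ _) (matches-prefix m (ω ∘ suc))
... | false rewrite eq = trans (*-identityˡ _) (matches-prefix m (ω ∘ suc))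

-- Each bit of `v` kills one of the two branches, and the bits after it are free.
𝔼-matches : ∀ {m′ m} (v : Vec Bool m′) → m′ ≤ m → 2 ^ m′ * 𝔼 m (matches v) ≤ 2 ^ m
𝔼-matches {m = m} [] _ = ≤-reflexive (trans (*-identityˡ _) (trans (𝔼-const m 1) (*-identityˡ _)))
𝔼-matches {suc m′} {suc m} (b ∷ v) (s≤s m′≤m) = begin
  2 * 2 ^ m′ * 𝔼 (suc m) (matches (b ∷ v)) ≡⟨ cong (2 * 2 ^ m′ *_) (one-branch b) ⟩
  2 * 2 ^ m′ * 𝔼 m (matches v)             ≡⟨ *-assoc 2 (2 ^ m′) _ ⟩
  2 * (2 ^ m′ * 𝔼 m (matches v))           ≤⟨ *-monoʳ-≤ 2 (𝔼-matches v m′≤m) ⟩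
  2 * 2 ^ m                                ∎
  where
  open ≤-Reasoning
  𝔼-cong : ∀ m {G H} → (∀ ω → G ω ≡ H ω) → 𝔼 m G ≡ 𝔼 m H
  𝔼-cong zero    e = e _
  𝔼-cong (suc m) e = cong₂ _+_ (𝔼-cong m (λ _ → e _)) (𝔼-cong m (λ _ → e _))
  one-branch : ∀ b → 𝔼 (suc m) (matches (b ∷ v)) ≡ 𝔼 m (matches v)
  one-branch true  = trans (cong₂ _+_ (𝔼-cong m (λ ω → *-identityˡ _)) (𝔼-const m 0)) (+-identityʳ _)
  one-branch false = cong₂ _+_ (𝔼-const m 0) (𝔼-cong m (λ ω → *-identityˡ _))

-- Overlaps are counted repeatedly. This still dominates the indicator of the event, and its mean is
-- a plain sum over the list.
covered : ∀ {m} → List (Vec Bool m) → Tape → ℕ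
covered []      ω = 0
covered (v ∷ A) ω = matches v ω + covered A ω

covered-∈ : ∀ {m} {A : List (Vec Bool m)} ω → prefix m ω List.∈ A → 1 ≤ covered A ω
covered-∈ {m} ω (here refl) = ≤-trans (≤-reflexive (sym (matches-prefix m ω))) (m≤m+n _ _)
covered-∈     ω (there i)   = ≤-trans (covered-∈ ω i) (m≤n+m _ _)

𝔼-covered : ∀ {m′ m} (A : List (Vec Bool m′)) → m′ ≤ m → 2 ^ m′ * 𝔼 m (covered A) ≤ length A * 2 ^ m
𝔼-covered {m′} {m} []      m′≤m = ≤-reflexive (trans (cong (2 ^ m′ *_) (𝔼-const m 0)) (*-zeroʳ (2 ^ m′)))
𝔼-covered {m′} {m} (v ∷ A) m′≤m = ≤-trans
  (≤-reflexive (trans (cong (2 ^ m′ *_) (𝔼-+ m _ _)) (*-distribˡ-+ (2 ^ m′) _ _)))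
  (+-mono-≤ (𝔼-matches v m′≤m) (𝔼-covered A m′≤m))

module Mean (g : ℕ) where

  -- The expectation of G is at most p / g.
  Mean : (Tape → ℕ) → ℕ → Set
  Mean G p = ∃ λ m₀ → ∀ {m} → m₀ ≤ m → g * 𝔼 m G ≤ p * 2 ^ m

  Mean-const : ∀ c → Mean (const c) (g * c)
  Mean-const c = 0 , λ {m} _ → ≤-reflexive (trans (cong (g *_) (𝔼-const m c)) (sym (*-assoc g c _)))

  -- A bound for all large `m` is what allows quantities decided by different numbers of bits to be
  -- added: take the larger threshold.
  Mean-+ : ∀ {G H p q} → Mean G p → Mean H q → Mean (λ ω → G ω + H ω) (p + q)
  Mean-+ {G} {H} {p} {q} (m₀ , b) (m₁ , c) = m₀ ⊔ m₁ , λ {m} h →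
    ≤-trans (≤-reflexive (trans (cong (g *_) (𝔼-+ m G H)) (*-distribˡ-+ g _ _)))
    (≤-trans (+-mono-≤ (b (≤-trans (m≤m⊔n m₀ m₁) h)) (c (≤-trans (m≤n⊔m m₀ m₁) h)))
      (≤-reflexive (sym (*-distribʳ-+ (2 ^ m) p q))))

  Mean-∑ : ∀ {n} {G : Fin n → Tape → ℕ} {p} → (∀ i → Mean (G i) (p i)) →
           Mean (λ ω → ∑[ i < n ] G i ω) (∑ n p)
  Mean-∑ {n} {G} {p} b = ∑ n (proj₁ ∘ b) , λ {m} h → begin
    g * 𝔼 m (λ ω → ∑[ i < n ] G i ω) ≡⟨ trans (cong (g *_) (𝔼-∑ m G)) (sym (∑-*ˡ g _)) ⟩
    ∑[ i < n ] (g * 𝔼 m (G i))       ≤⟨ ∑-mono (λ i → proj₂ (b i) (≤-trans (term≤∑ (proj₁ ∘ b) i) h)) ⟩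
    ∑[ i < n ] (p i * 2 ^ m)         ≡⟨ ∑-*ʳ p _ ⟩
    ∑ n p * 2 ^ m                    ∎
    where open ≤-Reasoning

  Mean-𝕊 : ∀ {X : Set} {u} (ins : Fin u → X → X) {G : Tape → X → ℕ} {p} →
           (∀ x → Mean (λ ω → G ω x) (p x)) → ∀ L x →
           Mean (λ ω → Walk.𝕊 ins L (G ω) x) (Walk.𝕊 ins L p x)
  Mean-𝕊 ins b zero    x = b x
  Mean-𝕊 ins b (suc L) x = Mean-∑ λ k → Mean-𝕊 ins b L (ins k x)

  Mean-covered : ∀ {m} (A : List (Vec Bool m)) → g * length A ≤ 2 ^ m → Mean (covered A) 1
  Mean-covered {m₀} A small = m₀ , λ {m} h → *-cancelˡ-≤ (2 ^ m₀) {{m^n≢0 2 m₀}} (begin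
    2 ^ m₀ * (g * 𝔼 m (covered A))  ≡⟨ shuffle (2 ^ m₀) g _ ⟩
    g * (2 ^ m₀ * 𝔼 m (covered A))  ≤⟨ *-monoʳ-≤ g (𝔼-covered A h) ⟩
    g * (length A * 2 ^ m)          ≡⟨ *-assoc g (length A) _ ⟨
    g * length A * 2 ^ m            ≤⟨ *-monoˡ-≤ (2 ^ m) small ⟩
    2 ^ m₀ * 2 ^ m                  ≡⟨ cong (2 ^ m₀ *_) (*-identityˡ _) ⟨
    2 ^ m₀ * (1 * 2 ^ m)            ∎)
    where
    open ≤-Reasoning
    shuffle : ∀ a b c → a * (b * c) ≡ b * (a * c)
    shuffle = solve-∀

  Mean-attained : ∀ {G p} → Mean G p → ∃ λ ω → g * G ω ≤ p
  Mean-attained {G} {p} (m , b) with 𝔼-attained m G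
  ... | ω , attained = ω , *-cancelˡ-≤ (2 ^ m) {{m^n≢0 2 m}} (begin
    2 ^ m * (g * G ω)  ≡⟨ shuffle (2 ^ m) g _ ⟩
    g * (2 ^ m * G ω)  ≤⟨ *-monoʳ-≤ g attained ⟩
    g * 𝔼 m G          ≤⟨ b ≤-refl ⟩
    p * 2 ^ m          ≡⟨ *-comm p _ ⟩
    2 ^ m * p          ∎)
    where
    open ≤-Reasoning
    shuffle : ∀ a b c → a * (b * c) ≡ b * (a * c)
    shuffle = solve-∀

-- Dereference tables as online allocators

pointers : ℕ → List Pointer
pointers zero    = [] ∷ []
pointers (suc s) = [] ∷ List.map (true ∷_) (pointers s) ++ List.map (false ∷_) (pointers s)

∈-pointers : ∀ {s} p → length p ≤ s → p List.∈ pointers s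
∈-pointers {zero}  []          _       = here refl
∈-pointers {suc s} []          _       = here refl
∈-pointers {suc s} (true ∷ p)  (s≤s h) = there (List.∈-++⁺ˡ (List.∈-map⁺ _ (∈-pointers p h)))
∈-pointers {suc s} (false ∷ p) (s≤s h) = there (List.∈-++⁺ʳ _ (List.∈-map⁺ _ (∈-pointers p h)))

length-pointers : ∀ s → suc (length (pointers s)) ≡ 2 ^ suc s
length-pointers zero    = refl
length-pointers (suc s) = begin
  suc (suc (length (List.map (true ∷_) (pointers s) ++ List.map (false ∷_) (pointers s))))
    ≡⟨ cong 2+ (trans (length-++ (List.map (true ∷_) (pointers s))) (cong₂ _+_ (length-map (true ∷_) (pointers s)) (length-map (false ∷_) (pointers s)))) ⟩
  suc (suc (ℓ + ℓ))    ≡⟨ cong suc (+-suc ℓ ℓ) ⟨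
  suc ℓ + suc ℓ        ≡⟨ cong₂ _+_ (length-pointers s) (length-pointers s) ⟩
  2 ^ suc s + 2 ^ suc s ≡⟨ cong (λ z → 2 ^ suc s + z) (+-identityʳ (2 ^ suc s)) ⟨
  2 ^ suc (suc s)      ∎
  where
  open ≡-Reasoning
  ℓ = length (pointers s)

∣p∪q∣≤∣p∣+∣q∣ : ∀ {n} (p q : Subset n) → ∣ p ∪ q ∣ ≤ ∣ p ∣ + ∣ q ∣
∣p∪q∣≤∣p∣+∣q∣ []          []          = z≤n
∣p∪q∣≤∣p∣+∣q∣ (true ∷ p)  (true ∷ q)  = s≤s (≤-trans (∣p∪q∣≤∣p∣+∣q∣ p q) (+-monoʳ-≤ ∣ p ∣ (n≤1+n _)))
∣p∪q∣≤∣p∣+∣q∣ (true ∷ p)  (false ∷ q) = s≤s (∣p∪q∣≤∣p∣+∣q∣ p q)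
∣p∪q∣≤∣p∣+∣q∣ (false ∷ p) (true ∷ q)  = ≤-trans (s≤s (∣p∪q∣≤∣p∣+∣q∣ p q)) (≤-reflexive (sym (+-suc ∣ p ∣ ∣ q ∣)))
∣p∪q∣≤∣p∣+∣q∣ (false ∷ p) (false ∷ q) = ∣p∪q∣≤∣p∣+∣q∣ p q

module _ {n u : ℕ} (T : Table n u) (ω : Tape) where
  open Table T

  pointer-alloc : ∀ h k → pointer T ω (alloc k ∷ h) k ≡ proj₂ (allocate ω (state T ω h) k)
  pointer-alloc h k = updateAt-updates k (pointer T ω h)

  pointer-alloc-other : ∀ h {k k′} → k′ ≢ k → pointer T ω (alloc k ∷ h) k′ ≡ pointer T ω h k′
  pointer-alloc-other h {k} {k′} ≢ = updateAt-minimal k′ k (pointer T ω h) ≢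

  pointer-dealloc : ∀ h k → pointer T ω (dealloc k ∷ h) k ≡ nothing
  pointer-dealloc h k with pointer T ω h k in eq
  ... | nothing = eq
  ... | just _  = updateAt-updates k (pointer T ω h)

  pointer-dealloc-other : ∀ h {k k′} → k′ ≢ k → pointer T ω (dealloc k ∷ h) k′ ≡ pointer T ω h k′
  pointer-dealloc-other h {k} {k′} ≢ with pointer T ω h k
  ... | nothing = refl
  ... | just _  = updateAt-minimal k′ k (pointer T ω h) ≢

  held⇒scheduled : ∀ {δ h k p} → Legal n δ h → pointer T ω h k ≡ just p → k ∈ scheduled h
  held⇒scheduled {h = alloc k′ ∷ h} {k} (alloc ℓ _ _) held with k Fin.≟ k′
  ... | yes refl = x∈p∪q⁺ (inj₁ (x∈⁅x⁆ k))
  ... | no  k≢k′ = x∈p∪q⁺ (inj₂ (held⇒scheduled ℓ (trans (sym (pointer-alloc-other h k≢k′)) held)))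
  held⇒scheduled {h = dealloc k′ ∷ h} {k} (dealloc ℓ _) held with k Fin.≟ k′
  ... | yes refl = contradiction (trans (sym held) (pointer-dealloc h k)) λ ()
  ... | no  k≢k′ = x∈p∧x≢y⇒x∈p-y (held⇒scheduled ℓ (trans (sym (pointer-dealloc-other h k≢k′)) held)) k≢k′

  position : History u → Fin u → Maybe (Fin n)
  position h k = Maybe.map (dereference ω k) (pointer T ω h k)

  position⁻ : ∀ h k {y} → position h k ≡ just y →
              ∃[ p ] (pointer T ω h k ≡ just p × dereference ω k p ≡ y)
  position⁻ h k e with pointer T ω h k
  ... | just p = p , refl , Maybe.just-injective e

  abstract
    occupied? : ∀ h y → Dec (∃[ k ] position h k ≡ just y)
    occupied? h y = Fin.any? λ k → Maybe.≡-dec Fin._≟_ (position h k) (just y)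

module Analysis {n u s M g : ℕ} {δ : ℚ} (T : Table n u)
  (distinct : ∀ {h} → Legal n δ h → ∀ ω {k₁ k₂ p₁ p₂} → k₁ ≢ k₂ →
              pointer T ω h k₁ ≡ just p₁ → pointer T ω h k₂ ≡ just p₂ →
              Table.dereference T ω k₁ p₁ ≢ Table.dereference T ω k₂ p₂)
  (failure  : ∀ {h k} → Legal n δ (alloc k ∷ h) → ∃[ m ] ∃[ A ]
              (∀ ω → Fails T h k ω → prefix m ω List.∈ A) × g * length A ≤ 2 ^ m)
  (sized    : FixedSize T δ s)
  (capacity : ∀ {z} → z < M → fromℕ z ℚ.< (1ℚ ℚ.- δ) ℚ.* fromℕ n)
  where
  open Table T
  open Mean g

  -- Legal histories and the cost of their failures

  Ok : History u → Op u → Set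
  Ok h (alloc k)   = k ∉ scheduled h × ∣ scheduled h ∣ < M
  Ok h (dealloc k) = k ∈ scheduled h

  abstract
    ok? : ∀ h o → Dec (Ok h o)
    ok? h (alloc k)   = ¬? (k ∈? scheduled h) ×-dec (∣ scheduled h ∣ <? M)
    ok? h (dealloc k) = k ∈? scheduled h

  attempt : ∀ h o → Dec (Ok h o) → History u
  attempt h o (yes _) = o ∷ h
  attempt h o (no _)  = h

  -- Operations that would be illegal are dropped, so that a walk may range over all key sequences.
  -- The test consults only `scheduled`, never the tape, so the resulting history is oblivious.
  play : List (Op u) → History u
  play []       = []
  play (o ∷ os) = attempt (play os) o (ok? (play os) o)

  legal-op : ∀ {h} o → Legal n δ h → Ok h o → Legal n δ (o ∷ h)
  legal-op (alloc k)   ℓ (new , room) = alloc ℓ new (capacity room)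
  legal-op (dealloc k) ℓ old          = dealloc ℓ old

  legal-attempt : ∀ {h} o → Legal n δ h → (d : Dec (Ok h o)) → Legal n δ (attempt h o d)
  legal-attempt o ℓ (yes ok) = legal-op o ℓ ok
  legal-attempt o ℓ (no _)   = ℓ

  legal : ∀ os → Legal n δ (play os)
  legal []       = start
  legal (o ∷ os) = legal-attempt o (legal os) (ok? (play os) o)

  -- A skipped allocation counts as a failure.
  op-cost : Tape → ∀ {h} o → Legal n δ h → Dec (Ok h o) → ℕ
  op-cost ω (alloc k)   ℓ (yes ok) = covered (proj₁ (proj₂ (failure (legal-op (alloc k) ℓ ok)))) ω
  op-cost ω (alloc k)   ℓ (no _)   = 1
  op-cost ω (dealloc k) ℓ _        = 0

  -- A bound on `g` times the mean of `op-cost`: a genuine failure has probability at most `1 / g`,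
  -- while a skip is certain.
  op-price : ∀ h o → Dec (Ok h o) → ℕ
  op-price h (alloc k)   (yes _) = 1
  op-price h (alloc k)   (no _)  = g
  op-price h (dealloc k) _       = 0

  cost : Tape → List (Op u) → ℕ
  cost ω []       = 0
  cost ω (o ∷ os) = op-cost ω o (legal os) (ok? (play os) o) + cost ω os

  price : List (Op u) → ℕ
  price []       = 0
  price (o ∷ os) = op-price (play os) o (ok? (play os) o) + price os

  Mean-op-cost : ∀ {h} o (ℓ : Legal n δ h) d → Mean (λ ω → op-cost ω o ℓ d) (op-price h o d)
  Mean-op-cost (alloc k)   ℓ (yes ok) = Mean-covered (proj₁ (proj₂ (failure (legal-op (alloc k) ℓ ok)))) (proj₂ (proj₂ (proj₂ (failure (legal-op (alloc k) ℓ ok)))))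
  Mean-op-cost (alloc k)   ℓ (no _)   = subst (Mean (const 1)) (*-identityʳ g) (Mean-const 1)
  Mean-op-cost (dealloc k) ℓ d        = subst (Mean (const 0)) (*-zeroʳ g) (Mean-const 0)

  Mean-cost : ∀ os → Mean (λ ω → cost ω os) (price os)
  Mean-cost []       = subst (Mean (const 0)) (*-zeroʳ g) (Mean-const 0)
  Mean-cost (o ∷ os) = Mean-+ {p = op-price (play os) o (ok? (play os) o)} {q = price os} (Mean-op-cost o (legal os) (ok? (play os) o)) (Mean-cost os)

  -- The table on a fixed tape as a process

  D : ℕ
  D = length (pointers s)

  full : Tape → List (Op u) → Fin n → Bool
  full ω os y = does (occupied? T ω (play os) y)

  slot : Tape → Fin u → Fin D → Fin n
  slot ω k i = dereference ω k (lookup (pointers s) i)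

  full⁻ : ∀ {ω os y} → full ω os y ≡ true → ∃[ k ] position T ω (play os) k ≡ just y
  full⁻ {ω} {os} {y} e with occupied? T ω (play os) y
  ... | yes p = p

  full⁺ : ∀ {ω os y k} → position T ω (play os) k ≡ just y → full ω os y ≡ true
  full⁺ {ω} {os} {y} p = dec-true (occupied? T ω (play os) y) (_ , p)

  position-injective : ∀ {ω h k k′ y} → Legal n δ h →
                       position T ω h k ≡ just y → position T ω h k′ ≡ just y → k ≡ k′
  position-injective {ω} {h} {k} {k′} ℓ p q with k Fin.≟ k′ | position⁻ T ω h k p | position⁻ T ω h k′ q
  ... | yes k≡k′ | _ | _ = k≡k′
  ... | no  k≢k′ | _ , held , at | _ , held′ , at′ =
    contradiction (trans at (sym at′)) (distinct ℓ ω k≢k′ held held′)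

  position⇒scheduled : ∀ {ω h k y} → Legal n δ h → position T ω h k ≡ just y → k ∈ scheduled h
  position⇒scheduled {ω} {h} {k} ℓ p with position⁻ T ω h k p
  ... | _ , held , _ = held⇒scheduled T ω ℓ held

  position-alloc-other : ∀ {ω h k k′ y} → Legal n δ h → k ∉ scheduled h →
                         position T ω h k′ ≡ just y → position T ω (alloc k ∷ h) k′ ≡ just y
  position-alloc-other {ω} {h} {k} {k′} ℓ new p = trans
    (cong (Maybe.map (dereference ω k′)) (pointer-alloc-other T ω h {k} {k′} λ { refl → new (position⇒scheduled ℓ p) })) p

  -- The holder of `y` keeps its pointer, being different from the newly scheduled key, and
  -- `dereference` does not see the state, so the slot stays the same.
  full-ins : ∀ ω k os y → full ω os y ≡ true → full ω (alloc k ∷ os) y ≡ true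
  full-ins ω k os y e = dec-true (occupied? T ω _ y) (kept (ok? (play os) (alloc k)))
    where
    kept : ∀ d → ∃[ k′ ] position T ω (attempt (play os) (alloc k) d) k′ ≡ just y
    kept (no _)          = full⁻ {ω} {os} e
    kept (yes (new , _)) with full⁻ {ω} {os} e
    ... | k′ , p = k′ , position-alloc-other (legal os) new p

  -- On a tape outside the cover the allocation succeeds, with a pointer listed in `pointers s`. An
  -- earlier holder of that slot would still be there afterwards; `distinct` would then identify it
  -- with `k`, which was not scheduled.
  place : ∀ ω k os → suc (cost ω os) ≤ cost ω (alloc k ∷ os) ⊎
          ∃[ i ] full ω os (slot ω k i) ≡ false × full ω (alloc k ∷ os) (slot ω k i) ≡ true
  place ω k os with ok? (play os) (alloc k)
  ... | no  _  = inj₁ ≤-refl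
  ... | yes ok@(new , room) with covered (proj₁ (proj₂ (failure (legal-op (alloc k) (legal os) ok)))) ω in unfailing
  ...   | suc c = inj₁ (s≤s (m≤n+m _ c))
  ...   | zero with proj₂ (allocate ω (state T ω (play os)) k) in result
  ...     | nothing = contradiction
    (≤-trans (covered-∈ ω (proj₁ (proj₂ (proj₂ (failure (legal-op (alloc k) (legal os) ok)))) ω result)) (≤-reflexive unfailing)) λ ()
  ...     | just p = inj₂ (i , dec-false (occupied? T ω h _) vacant , dec-true (occupied? T ω (alloc k ∷ h) _) (k , filled))
    where
    h = play os
    held : pointer T ω (alloc k ∷ h) k ≡ just p
    held = trans (pointer-alloc T ω h k) result
    known : p List.∈ pointers s
    known = ∈-pointers p (sized (legal-op (alloc k) (legal os) ok) ω held)
    i : Fin D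
    i = index known
    filled : position T ω (alloc k ∷ h) k ≡ just (slot ω k i)
    filled = trans (cong (Maybe.map (dereference ω k)) held) (cong (λ p → just (dereference ω k p)) (lookup-index known))
    vacant : ¬ (∃[ k′ ] position T ω h k′ ≡ just (slot ω k i))
    vacant (k′ , q) with position-injective (legal-op (alloc k) (legal os) ok) (position-alloc-other (legal os) new q) filled
    ... | refl = new (position⇒scheduled (legal os) q)

  process : Tape → Process n u D
  process ω = record
    { X        = List (Op u)
    ; ins      = λ k os → alloc k ∷ os
    ; full     = full ω
    ; cost     = cost ω
    ; slot     = slot ω
    ; full-ins = full-ins ω
    ; cost-ins = λ k os → m≤n+m _ _
    ; place    = place ω
    }

  -- The price of random insertions

  size : List (Op u) → ℕ
  size os = ∣ scheduled (play os) ∣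

  size-alloc : ∀ k os → size (alloc k ∷ os) ≤ suc (size os)
  size-alloc k os with ok? (play os) (alloc k)
  ... | no  _ = n≤1+n _
  ... | yes _ = ≤-trans (∣p∪q∣≤∣p∣+∣q∣ ⁅ k ⁆ _) (≤-reflexive (cong (_+ size os) (∣⁅x⁆∣≡1 k)))

  ins : Fin u → List (Op u) → List (Op u)
  ins k os = alloc k ∷ os
  open Walk ins

  module _ (M≤n : M ≤ n) (gn≤u : g * n ≤ u) where

    -- Summed over the keys, failures cost at most `u`, and the at most n keys already scheduled
    -- cost `g` each, at most `u` again.
    price-alloc : ∀ {os} → size os < M → ∑[ k < u ] price (ins k os) ≤ u * (price os + 2)
    price-alloc {os} room = begin
      ∑[ k < u ] price (ins k os)
        ≤⟨ ∑-mono (λ k → +-monoˡ-≤ (price os) (bound k)) ⟩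
      ∑[ k < u ] (1 + g * ⟦ Vec.lookup p k ⟧ + price os)
        ≡⟨ trans (∑-+ _ _) (cong₂ _+_ (∑-+ _ _) (∑-const u (price os))) ⟩
      ∑[ k < u ] 1 + ∑[ k < u ] (g * ⟦ Vec.lookup p k ⟧) + u * price os
        ≡⟨ cong (_+ u * price os) (cong₂ _+_ (∑-const u 1) (trans (∑-*ˡ g _) (cong (g *_) (∑-lookup p)))) ⟩
      u * 1 + g * ∣ p ∣ + u * price os
        ≤⟨ +-monoˡ-≤ (u * price os) (+-monoʳ-≤ (u * 1) (≤-trans (*-monoʳ-≤ g (≤-trans (<⇒≤ room) M≤n)) gn≤u)) ⟩
      u * 1 + u + u * price os
        ≡⟨ collect u (price os) ⟩
      u * (price os + 2) ∎
      where
      open ≤-Reasoning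
      p : Subset u
      p = scheduled (play os)
      collect : ∀ u c → u * 1 + u + u * c ≡ u * (c + 2)
      collect = solve-∀
      bound : ∀ k → op-price (play os) (alloc k) (ok? (play os) (alloc k)) ≤ 1 + g * ⟦ Vec.lookup p k ⟧
      bound k with ok? (play os) (alloc k)
      ... | yes _  = s≤s z≤n
      ... | no ¬ok with Vec.lookup p k in eq
      ...   | true  = ≤-trans (≤-reflexive (sym (*-identityʳ g))) (n≤1+n _)
      ...   | false = contradiction ((λ k∈p → contradiction (trans (sym ([]=⇒lookup k∈p)) eq) λ ()) , room) ¬ok

    𝕊-price : ∀ L {os} → size os + L ≤ M → 𝕊 L price os ≤ u ^ L * (price os + L * 2)
    𝕊-price = 𝕊-growth (λ os L → size os + L ≤ M) price 2
      (λ k {os} {L} room → ≤-trans (+-monoˡ-≤ L (size-alloc k os)) (≤-trans (≤-reflexive (sym (+-suc (size os) L))) room))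
      (λ {os} {L} room → price-alloc {os} (≤-trans (m≤m+n (suc (size os)) L) (≤-trans (≤-reflexive (sym (+-suc (size os) L))) room)))

    -- The tape is fixed here: one is chosen whose cost, summed over all key sequences, is at most
    -- its mean. From then on the argument is deterministic.
    crowding-bound : ∀ a L → .{{_ : NonZero n}} → .{{_ : NonZero u}} → .{{_ : NonZero D}} →
                     .{{_ : NonZero a}} → .{{_ : NonZero L}} →
                     suc D * L ≤ M → n ≤ 2 * a * suc D * L → g < (16 * a * suc D * D) ^ (2 ^ suc D)
    crowding-bound a L PL≤M short with Mean-attained (Mean-𝕊 ins Mean-cost (suc D * L) [])
    ... | ω , cheap = Collapse.collapse (process ω) a g L [] short (≤-trans cheap (≤-trans
      (𝕊-price (suc D * L) (≤-trans (+-monoˡ-≤ (suc D * L) (≤-reflexive (∣⊥∣≡0 u))) PL≤M))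
      (≤-reflexive (shuffle (u ^ (suc D * L)) (suc D * L)))))
      where
      shuffle : ∀ p t → p * (t * 2) ≡ 2 * t * p
      shuffle = solve-∀

  -- Histories that fill the table and free a block

  allocs deallocs : List (Fin u) → List (Op u)
  allocs   = List.map alloc
  deallocs = List.map dealloc

  scheduled-attempt : ∀ h {k k′} d → k′ ∈ scheduled (attempt h (alloc k) d) → k′ ≡ k ⊎ k′ ∈ scheduled h
  scheduled-attempt h (no _)  k′∈ = inj₂ k′∈
  scheduled-attempt h {k} (yes _) k′∈ with x∈p∪q⁻ ⁅ k ⁆ (scheduled h) k′∈
  ... | inj₁ e = inj₁ (x∈⁅y⁆⇒x≡y k e)
  ... | inj₂ e = inj₂ e

  scheduled-allocs : ∀ ks {k} → k ∈ scheduled (play (allocs ks)) → k List.∈ ks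
  scheduled-allocs []       k∈ = contradiction k∈ ∉⊥
  scheduled-allocs (k ∷ ks) k∈ with scheduled-attempt (play (allocs ks)) (ok? (play (allocs ks)) (alloc k)) k∈
  ... | inj₁ refl = here refl
  ... | inj₂ e    = there (scheduled-allocs ks e)

  size-allocs : ∀ ks → size (allocs ks) ≤ length ks
  size-allocs []       = ≤-reflexive (∣⊥∣≡0 u)
  size-allocs (k ∷ ks) = ≤-trans (size-alloc k (allocs ks)) (s≤s (size-allocs ks))

  allocs-ok : ∀ {k ks} → Unique (k ∷ ks) → length (k ∷ ks) ≤ M → Ok (play (allocs ks)) (alloc k)
  allocs-ok {k} {ks} (k∉ks ∷ _) room =
    (λ k∈ → All¬⇒¬Any k∉ks (scheduled-allocs ks k∈)) , ≤-trans (s≤s (size-allocs ks)) room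

  allocs-scheduled : ∀ {ks} → Unique ks → length ks ≤ M → ∀ {k} → k List.∈ ks → k ∈ scheduled (play (allocs ks))
  allocs-scheduled {k ∷ ks} uniq@(_ ∷ uniq′) room k∈ with ok? (play (allocs ks)) (alloc k)
  ... | no ¬ok = contradiction (allocs-ok uniq room) ¬ok
  ... | yes _ with k∈
  ...   | here refl = x∈p∪q⁺ (inj₁ (x∈⁅x⁆ k))
  ...   | there e   = x∈p∪q⁺ (inj₂ (allocs-scheduled uniq′ (<⇒≤ room) e))

  price-allocs : ∀ {ks} → Unique ks → length ks ≤ M → price (allocs ks) ≡ length ks
  price-allocs {[]}     _    _    = refl
  price-allocs {k ∷ ks} uniq@(_ ∷ uniq′) room with ok? (play (allocs ks)) (alloc k)
  ... | no ¬ok = contradiction (allocs-ok uniq room) ¬ok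
  ... | yes _  = cong suc (price-allocs uniq′ (<⇒≤ room))

  cost-deallocs : ∀ {ω} ks os → cost ω (deallocs ks ++ os) ≡ cost ω os
  cost-deallocs []       os = refl
  cost-deallocs (k ∷ ks) os = cost-deallocs ks os

  price-deallocs : ∀ ks os → price (deallocs ks ++ os) ≡ price os
  price-deallocs []       os = refl
  price-deallocs (k ∷ ks) os = price-deallocs ks os

  position-deallocs : ∀ {ω} ks os {k} → ¬ (k List.∈ ks) →
                      position T ω (play (deallocs ks ++ os)) k ≡ position T ω (play os) k
  position-deallocs []        os k∉ = refl
  position-deallocs {ω} (k′ ∷ ks) os {k} k∉ = trans (same (ok? h (dealloc k′))) (position-deallocs ks os (k∉ ∘ there))
    where
    h = play (deallocs ks ++ os)
    same : ∀ d → position T ω (attempt h (dealloc k′) d) k ≡ position T ω h k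
    same (no _)  = refl
    same (yes _) = cong (Maybe.map (dereference ω k)) (pointer-dealloc-other T ω h {k′} {k} (k∉ ∘ here))

  scheduled-deallocs : ∀ ks os {k} → ¬ (k List.∈ ks) → k ∈ scheduled (play os) →
                       k ∈ scheduled (play (deallocs ks ++ os))
  scheduled-deallocs []        os k∉ k∈ = k∈
  scheduled-deallocs (k′ ∷ ks) os {k} k∉ k∈ with ok? (play (deallocs ks ++ os)) (dealloc k′)
  ... | no  _ = scheduled-deallocs ks os (k∉ ∘ there) k∈
  ... | yes _ = x∈p∧x≢y⇒x∈p-y (scheduled-deallocs ks os (k∉ ∘ there) k∈) (k∉ ∘ here)

  size-deallocs : ∀ {ks} os → Unique ks → (∀ {k} → k List.∈ ks → k ∈ scheduled (play os)) →
                  size (deallocs ks ++ os) + length ks ≤ size os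
  size-deallocs {[]}     os _ _ = ≤-reflexive (+-identityʳ _)
  size-deallocs {k ∷ ks} os (k∉ks ∷ uniq) ⊆os = ≤-trans (≤-reflexive (+-suc _ (length ks)))
    (≤-trans (+-monoˡ-≤ (length ks) (smaller (ok? h (dealloc k)))) (size-deallocs os uniq (⊆os ∘ there)))
    where
    h = play (deallocs ks ++ os)
    k∈h : k ∈ scheduled h
    k∈h = scheduled-deallocs ks os (All¬⇒¬Any k∉ks) (⊆os (here refl))
    smaller : ∀ d → ∣ scheduled (attempt h (dealloc k) d) ∣ < ∣ scheduled h ∣
    smaller (yes _) = x∈p⇒∣p-x∣<∣p∣ k∈h
    smaller (no ¬k) = contradiction k∈h ¬k

  module Churn {B R : ℕ} (M≤n : M ≤ n) (gn≤u : g * n ≤ u) (M≤u : M ≤ u) (BR≤M : B * R ≤ M) where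

    key : Fin M → Fin u
    key i = Fin.inject≤ i M≤u

    key-injective : ∀ {i j} → key i ≡ key j → i ≡ j
    key-injective = Fin.inject≤-injective M≤u M≤u _ _

    -- The first `B * R` of the loaded keys, cut into `B` consecutive blocks. Averaging over this
    -- fixed partition plays the part of a random block.
    block-key : Fin B → Fin R → Fin u
    block-key b i = key (Fin.inject≤ (Fin.combine b i) BR≤M)

    block-key-injective : ∀ {b i b′ i′} → block-key b i ≡ block-key b′ i′ → b ≡ b′ × i ≡ i′
    block-key-injective e = Fin.combine-injective _ _ _ _ (Fin.inject≤-injective BR≤M BR≤M _ _ (key-injective e))

    initial : List (Fin u)
    initial = List.tabulate key

    block : Fin B → List (Fin u)
    block b = List.tabulate (block-key b)

    initial-unique : Unique initial
    initial-unique = tabulate⁺ key-injective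

    initial-fits : length initial ≤ M
    initial-fits = ≤-reflexive (length-tabulate key)

    loaded : List (Op u)
    loaded = allocs initial

    freed : Fin B → List (Op u)
    freed b = deallocs (block b) ++ loaded

    price-freed : ∀ b → price (freed b) ≡ M
    price-freed b = trans (price-deallocs (block b) loaded) (trans (price-allocs initial-unique initial-fits) (length-tabulate key))

    size-freed : ∀ b → size (freed b) + R ≤ M
    size-freed b = begin
      size (freed b) + R                 ≡⟨ cong (λ z → size (freed b) + z) (length-tabulate (block-key b)) ⟨
      size (freed b) + length (block b)  ≤⟨ size-deallocs loaded (tabulate⁺ (proj₂ ∘ block-key-injective)) block⊆ ⟩
      size loaded                        ≤⟨ size-allocs initial ⟩
      length initial                     ≤⟨ initial-fits ⟩
      M                                  ∎
      where
      open ≤-Reasoning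
      block⊆ : ∀ {k} → k List.∈ block b → k ∈ scheduled (play loaded)
      block⊆ k∈ with List.∈-tabulate⁻ k∈
      ... | i , refl = allocs-scheduled initial-unique initial-fits (List.∈-tabulate⁺ _)

    module _ (ω : Tape) where

      at? : ∀ b i y → Dec (position T ω (play loaded) (block-key b i) ≡ just y)
      at? b i y = Maybe.≡-dec Fin._≟_ _ _

      removed : Fin B → Fin n → ℕ
      removed b y = ∑[ i < R ] 𝟙[ at? b i y ]

      at⁻ : ∀ {b i y} → 𝟙[ at? b i y ] ≢ 0 → position T ω (play loaded) (block-key b i) ≡ just y
      at⁻ {b} {i} {y} ≢0 with 𝟙[ at? b i y ] | indicator (at? b i y)
      ... | _ | holds p = p
      ... | _ | fails _ = contradiction refl ≢0

      -- If the key at `y` is outside the block, freeing the block does not move it; otherwise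
      -- `removed` counts it.
      covers : ∀ b y → ⟦ full ω loaded y ⟧ ≤ ⟦ full ω (freed b) y ⟧ + removed b y
      covers b y with full ω loaded y in eq
      ... | false = z≤n
      ... | true with full⁻ {ω} {loaded} eq
      ...   | k , p with any? (k Fin.≟_) (block b)
      ...     | no  k∉ = ≤-trans (≤-reflexive (cong ⟦_⟧ (sym (full⁺ {ω} {freed b} (trans (position-deallocs (block b) loaded k∉) p))))) (m≤m+n _ _)
      ...     | yes k∈ with List.∈-tabulate⁻ k∈
      ...       | i , refl = ≤-trans (≤-trans one (term≤∑ (λ i → 𝟙[ at? b i y ]) i)) (m≤n+m _ _)
        where
        one : 1 ≤ 𝟙[ at? b i y ]
        one with 𝟙[ at? b i y ] | indicator (at? b i y)
        ... | _ | holds _ = ≤-refl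
        ... | _ | fails q = contradiction p q

      few : ∀ b → ∑ n (removed b) ≤ R
      few b = ≤-trans (≤-reflexive (∑-swap _)) (≤-trans
        (∑-≤-const λ i → ∑-≤-unique _ (λ y → 𝟙[ _ ]≤1) λ y y′ p q → Maybe.just-injective (trans (sym (at⁻ p)) (at⁻ q)))
        (≤-reflexive (*-identityʳ R)))

      once : ∀ y → ∑[ b < B ] removed b y ≤ 1
      once y = ∑-≤-unique _
        (λ b → ∑-≤-unique _ (λ i → 𝟙[ _ ]≤1) λ i i′ p q → proj₂ (same (at⁻ p) (at⁻ q)))
        λ b b′ p q → let i , p′ = ∑≢0⇒term≢0 _ p ; i′ , q′ = ∑≢0⇒term≢0 _ q in proj₁ (same (at⁻ p′) (at⁻ q′))
        where
        same : ∀ {b i b′ i′} → position T ω (play loaded) (block-key b i) ≡ just y →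
               position T ω (play loaded) (block-key b′ i′) ≡ just y → b ≡ b′ × i ≡ i′
        same p q = block-key-injective (position-injective {ω} {play loaded} (legal loaded) p q)

      module _ .{{_ : NonZero n}} .{{_ : NonZero u}} .{{_ : NonZero D}} where

        open Refill (process ω)

        filled : ∀ ks → length ks ≤ #full (allocs ks) + cost ω (allocs ks)
        filled []       = z≤n
        filled (k ∷ ks) = ≤-trans (s≤s (filled ks)) (#full-ins k (allocs ks))

        churned : 32 * D * R ≤ n →
          u ^ R * (2 * B * (4 * M + 3 * R)) ≤ u ^ R * (8 * n * B + n) + 8 * ∑[ b < B ] 𝕊 R (cost ω) (freed b)
        churned R-small = churn loaded freed removed R-small covers few once
          (≤-trans (≤-reflexive (sym (length-tabulate key))) (filled initial))
          (λ b → ≤-reflexive (sym (cost-deallocs (block b) loaded)))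

    -- `churned` compares the blocks on one and the same tape, so the tape is chosen for the sum of
    -- the costs over all blocks.
    churn-bound : .{{_ : NonZero n}} → .{{_ : NonZero u}} → .{{_ : NonZero D}} → 32 * D * R ≤ n →
      g * (2 * B * (4 * M + 3 * R)) ≤ g * (8 * n * B + n) + 8 * (B * (M + R * 2))
    churn-bound R-small with Mean-attained (Mean-∑ λ b → Mean-𝕊 ins Mean-cost R (freed b))
    ... | ω , cheap = *-cancelˡ-≤ p {{m^n≢0 u R}} (begin
      p * (g * (2 * B * (4 * M + 3 * R)))    ≡⟨ swap p g _ ⟩
      g * (p * (2 * B * (4 * M + 3 * R)))    ≤⟨ *-monoʳ-≤ g (churned ω R-small) ⟩
      g * (p * (8 * n * B + n) + 8 * C)      ≡⟨ distribute g p (8 * n * B + n) C ⟩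
      p * (g * (8 * n * B + n)) + 8 * (g * C) ≤⟨ +-monoʳ-≤ (p * (g * (8 * n * B + n))) (*-monoʳ-≤ 8 (≤-trans cheap (∑-≤-const priced))) ⟩
      p * (g * (8 * n * B + n)) + 8 * (B * (p * (M + R * 2))) ≡⟨ factor p (g * (8 * n * B + n)) B (M + R * 2) ⟩
      p * (g * (8 * n * B + n) + 8 * (B * (M + R * 2))) ∎)
      where
      open ≤-Reasoning
      p C : ℕ
      p = u ^ R
      C = ∑[ b < B ] 𝕊 R (cost ω) (freed b)
      priced : ∀ b → 𝕊 R price (freed b) ≤ p * (M + R * 2)
      priced b = ≤-trans (𝕊-price M≤n gn≤u R (size-freed b)) (≤-reflexive (cong (λ z → p * (z + R * 2)) (price-freed b)))
      swap : ∀ a b c → a * (b * c) ≡ b * (a * c)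
      swap = solve-∀
      distribute : ∀ g p x c → g * (p * x + 8 * c) ≡ p * (g * x) + 8 * (g * c)
      distribute = solve-∀
      factor : ∀ p x b y → p * x + 8 * (b * (p * y)) ≡ p * (x + 8 * (b * y))
      factor = solve-∀

-- Rational parameters

numerator : ℚ → ℕ
numerator q = ℤ.∣ ℚ.numerator q ∣

denominator : ℚ → ℕ
denominator = ℚ.denominatorℕ

toℚᵘ-fromℕ : ∀ n → toℚᵘ (fromℕ n) ≃ mkℚᵘ (+ n) 0
toℚᵘ-fromℕ n = ℚ.toℚᵘ-fromℚᵘ (mkℚᵘ (+ n) 0)

fromℕ-mono : ∀ {m n} → m ≤ n → fromℕ m ℚ.≤ fromℕ n
fromℕ-mono {m} {n} m≤n = ℚ.toℚᵘ-cancel-≤ (begin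
  toℚᵘ (fromℕ m)  ≃⟨ toℚᵘ-fromℕ m ⟩
  mkℚᵘ (+ m) 0    ≤⟨ ℚᵘ.*≤* (ℤ.*-monoʳ-≤-nonNeg (+ 1) (ℤ.+≤+ m≤n)) ⟩
  mkℚᵘ (+ n) 0    ≃⟨ toℚᵘ-fromℕ n ⟨
  toℚᵘ (fromℕ n)  ∎)
  where open ℚᵘ.≤-Reasoning

*-fromℕ-≤ : ∀ δ → .{{_ : Positive δ}} → ∀ x y →
            δ ℚ.* fromℕ x ℚ.≤ fromℕ y → numerator δ * x ≤ denominator δ * y
*-fromℕ-≤ δ@(mkℚ +[1+ p ] q _) x y h = ℤ.drop‿+≤+ (begin
  + (suc p * x)                ≡⟨ ℤ.pos-* (suc p) x ⟩
  + suc p ℤ.* + x              ≡⟨ ℤ.*-identityʳ _ ⟨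
  + suc p ℤ.* + x ℤ.* + 1      ≤⟨ ℚᵘ.drop-*≤* unnormalised ⟩
  + y ℤ.* + (suc q * 1)        ≡⟨ cong (λ z → + y ℤ.* + z) (*-identityʳ (suc q)) ⟩
  + y ℤ.* + suc q              ≡⟨ ℤ.*-comm (+ y) (+ suc q) ⟩
  + suc q ℤ.* + y              ≡⟨ ℤ.pos-* (suc q) y ⟨
  + (suc q * y)                ∎)
  where
  open ℤ.≤-Reasoning
  unnormalised : mkℚᵘ (+ suc p) q ℚᵘ.* mkℚᵘ (+ x) 0 ℚᵘ.≤ mkℚᵘ (+ y) 0
  unnormalised = ℚᵘ.≤-respʳ-≃ (toℚᵘ-fromℕ y) (ℚᵘ.≤-respˡ-≃
    (ℚᵘ.≃-trans (ℚ.toℚᵘ-homo-* δ (fromℕ x)) (ℚᵘ.*-congˡ {mkℚᵘ (+ suc p) q} (toℚᵘ-fromℕ x))) (ℚ.toℚᵘ-mono-≤ h))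

fromℕ-≤-+-* : ∀ δ → .{{_ : Positive δ}} → ∀ x y z →
              fromℕ x ℚ.≤ fromℕ y ℚ.+ δ ℚ.* fromℕ z →
              denominator δ * x ≤ denominator δ * y + numerator δ * z
fromℕ-≤-+-* δ@(mkℚ +[1+ p ] q _) x y z h = ℤ.drop‿+≤+ (begin
  + (suc q * x)                                  ≡⟨ cong +_ (*-comm (suc q) x) ⟩
  + (x * suc q)                                  ≡⟨ ℤ.pos-* x (suc q) ⟩
  + x ℤ.* + suc q                                ≡⟨ cong (λ t → + x ℤ.* + t) (trans (*-identityˡ _) (*-identityʳ _)) ⟨
  + x ℤ.* + (1 * (suc q * 1))                    ≤⟨ ℚᵘ.drop-*≤* unnormalised ⟩
  (+ y ℤ.* + (suc q * 1) ℤ.+ + suc p ℤ.* + z ℤ.* + 1) ℤ.* + 1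
    ≡⟨ trans (ℤ.*-identityʳ _) (cong₂ ℤ._+_ (cong (λ t → + y ℤ.* + t) (*-identityʳ (suc q))) (ℤ.*-identityʳ _)) ⟩
  + y ℤ.* + suc q ℤ.+ + suc p ℤ.* + z            ≡⟨ cong₂ ℤ._+_ (trans (ℤ.*-comm (+ y) (+ suc q)) (sym (ℤ.pos-* (suc q) y))) (sym (ℤ.pos-* (suc p) z)) ⟩
  + (suc q * y) ℤ.+ + (suc p * z)                ≡⟨ ℤ.pos-+ (suc q * y) (suc p * z) ⟨
  + (suc q * y + suc p * z)                      ∎)
  where
  open ℤ.≤-Reasoning
  unnormalised : mkℚᵘ (+ x) 0 ℚᵘ.≤ mkℚᵘ (+ y) 0 ℚᵘ.+ mkℚᵘ (+ suc p) q ℚᵘ.* mkℚᵘ (+ z) 0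
  unnormalised = ℚᵘ.≤-respˡ-≃ (toℚᵘ-fromℕ x) (ℚᵘ.≤-respʳ-≃
    (ℚᵘ.≃-trans (ℚ.toℚᵘ-homo-+ (fromℕ y) (δ ℚ.* fromℕ z))
      (ℚᵘ.+-cong (toℚᵘ-fromℕ y) (ℚᵘ.≃-trans (ℚ.toℚᵘ-homo-* δ (fromℕ z)) (ℚᵘ.*-congˡ {mkℚᵘ (+ suc p) q} (toℚᵘ-fromℕ z)))))
    (ℚ.toℚᵘ-mono-≤ h))

/-≤-1/ : ∀ a m f → .{{_ : NonZero m}} → .{{_ : NonZero f}} → + a ℚ./ m ℚ.≤ + 1 ℚ./ f → f * a ≤ m
/-≤-1/ a m@(suc m′) f@(suc f′) h = ℤ.drop‿+≤+ (begin
  + (f * a)        ≡⟨ cong +_ (*-comm f a) ⟩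
  + (a * f)        ≡⟨ ℤ.pos-* a f ⟩
  + a ℤ.* + f      ≤⟨ ℚᵘ.drop-*≤* (ℚᵘ.≤-respʳ-≃ (ℚ.toℚᵘ-fromℚᵘ (mkℚᵘ (+ 1) f′)) (ℚᵘ.≤-respˡ-≃ (ℚ.toℚᵘ-fromℚᵘ (mkℚᵘ (+ a) m′)) (ℚ.toℚᵘ-mono-≤ h))) ⟩
  + 1 ℤ.* + m      ≡⟨ ℤ.*-identityˡ (+ m) ⟩
  + m              ∎)
  where open ℤ.≤-Reasoning

log₂⌈1/⌉-≤ : ∀ δ → .{{_ : Positive δ}} → ∀ {z e} →
             denominator δ ≤ numerator δ * z → z ≤ 2 ^ e → log₂⌈1/ δ ⌉ ≤ e
log₂⌈1/⌉-≤ δ {z} {e} h z≤2^e = ≤-trans (⌈log₂⌉-mono-≤ (≤-trans (ceil δ h) z≤2^e)) (≤-reflexive (⌈log₂2^n⌉≡n e))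
  where
  ceil : ∀ δ → .{{_ : Positive δ}} → denominator δ ≤ numerator δ * z →
         ℤ.∣ ℚ.ceiling ((ℚ.1/ δ) {{ℚ.pos⇒nonZero δ}}) ∣ ≤ z
  ceil (mkℚ +[1+ p ] q _) h
    -- The ceiling of 1/δ is minus the floor of -1/δ, which is this integer quotient. A quotient
    -- `-[1+ k ]` makes the ceiling `suc k`, so `k < z` is to be shown.
    with -[1+ q ] ℤ./ + suc p | ℤ.div-pos-is-/ℕ -[1+ q ] (suc p) | ℤ.[n/ℕd]*d≤n -[1+ q ] (suc p) | ℤ.n<s[n/ℕd]*d -[1+ q ] (suc p)
  ... | _ | refl | low | high with -[1+ q ] ℤ./ℕ suc p
  ...   | + k       = contradiction (ℤ.≤-trans (ℤ.≤-reflexive (ℤ.pos-* k (suc p))) low) λ ()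
  ...   | -[1+ k ]  = *-cancelˡ-< (suc p) k z (≤-trans (ℤ.drop‿+<+ below) h)
    where
    below : + (suc p * k) ℤ.< + suc q
    below = ℤ.neg-cancel-< (ℤ.<-≤-trans high (ℤ.≤-reflexive (eq k)))
      where
      eq : ∀ k → ℤ.suc -[1+ k ] ℤ.* + suc p ≡ ℤ.- + (suc p * k)
      eq zero    = sym (cong (λ t → ℤ.- + t) (*-zeroʳ (suc p)))
      eq (suc k) = cong (λ t → ℤ.- + t) (*-comm (suc k) (suc p))

-- `M` is the least natural number that is at least `cap`. As an allocation needs strictly fewer
-- than `cap` keys, exactly `M` keys can be scheduled together.
find-capacity : ∀ cap N → cap ℚ.≤ fromℕ N →
                ∃[ M ] M ≤ N × (∀ {z} → z < M → fromℕ z ℚ.< cap) × cap ℚ.≤ fromℕ M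
find-capacity cap zero    h = 0 , z≤n , (λ ()) , h
find-capacity cap (suc N) h with cap ℚ.≤? fromℕ N
... | yes h′ = let M , M≤N , rest = find-capacity cap N h′ in M , m≤n⇒m≤1+n M≤N , rest
... | no  ¬h = suc N , ≤-refl , (λ z<sN → ℚ.≤-<-trans (fromℕ-mono (s≤s⁻¹ z<sN)) (ℚ.≰⇒> ¬h)) , h

-- The lower bound

n≤2^n : ∀ n → n ≤ 2 ^ n
n≤2^n zero    = z≤n
n≤2^n (suc n) = begin
  1 + n          ≤⟨ +-mono-≤ (m^n>0 2 n) (n≤2^n n) ⟩
  2 ^ n + 2 ^ n  ≡⟨ cong (λ z → 2 ^ n + z) (+-identityʳ (2 ^ n)) ⟨
  2 ^ suc n      ∎
  where open ≤-Reasoning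

⌈log₂⌉-≤ : ∀ {m e} → m ≤ 2 ^ e → ⌈log₂ m ⌉ ≤ e
⌈log₂⌉-≤ {e = e} h = ≤-trans (⌈log₂⌉-mono-≤ h) (≤-reflexive (⌈log₂2^n⌉≡n e))

m<n+m/n*n : ∀ m n → .{{_ : NonZero n}} → m < n + m / n * n
m<n+m/n*n m n = ≤-trans (s≤s (≤-reflexive (m≡m%n+[m/n]*n m n))) (+-monoˡ-≤ (m / n * n) (m%n<n m n))

positive-numerator : ∀ q → .{{_ : Positive q}} → NonZero (numerator q)
positive-numerator (mkℚ +[1+ _ ] _ _) = _

fromℕ-nonNeg : ∀ n → ℚ.NonNegative (fromℕ n)
fromℕ-nonNeg n = ℚ.nonNegative (fromℕ-mono {0} {n} z≤n)

-- Here δ is `p / q`. With n - M ≤ δn, 6BR ≥ 3n/2 and M + 2R ≤ 2n, the churn inequality becomes 1 ≤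
-- 256Dδ + 512D/g, which is `ratio`. If g exceeds 1024D, the last term is below 1/2 and δ ≥ 1/(512D)
-- remains.
churn-ratio : ∀ {B D M R g n p q} → .{{_ : NonZero n}} →
  g * (2 * B * (4 * M + 3 * R)) ≤ g * (8 * n * B + n) + 8 * (B * (M + R * 2)) →
  q * n ≤ q * M + p * n → B ≡ 16 * D → n ≤ 4 * (B * R) → M ≤ n → R * 2 ≤ n →
  q ≤ p * (512 * D) ⊎ g ≤ 1024 * D
churn-ratio {B} {D} {M} {R} {g} {n} {p} {q} h load refl n≤4BR M≤n 2R≤n with g ≤? 1024 * D
... | yes small = inj₂ small
... | no  large = inj₁ (*-cancelˡ-≤ g {{>-nonZero (≤-trans (s≤s z≤n) (≰⇒> large))}} (+-cancelˡ-≤ (g * q) _ _ (begin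
  g * q + g * q                           ≤⟨ +-mono-≤ ratio ratio ⟩
  (512 * D * q + 256 * g * D * p) + (512 * D * q + 256 * g * D * p) ≡⟨ eq₆ D g p q ⟩
  1024 * D * q + g * (p * (512 * D))      ≤⟨ +-monoˡ-≤ (g * (p * (512 * D))) (*-monoˡ-≤ q (<⇒≤ (≰⇒> large))) ⟩
  g * q + g * (p * (512 * D))             ∎)))
  where
  open ≤-Reasoning
  eq₁ : ∀ B M R g q → 8 * g * B * (q * M) + 6 * g * q * (B * R) ≡ q * (g * (2 * B * (4 * M + 3 * R)))
  eq₁ = solve-∀
  eq₂ : ∀ B M R g n p q → 8 * g * B * (q * M + p * n) + q * (g * (8 * n * B + n) + 8 * (B * (M + R * 2))) ≡
        8 * g * B * (q * n) + 8 * g * B * (q * M) + (8 * g * B * p * n + g * q * n + 8 * (B * q) * (M + R * 2))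
  eq₂ = solve-∀
  eq₃ : ∀ a b c → a + (b + c) ≡ a + b + c
  eq₃ = solve-∀
  eq₄ : ∀ B R g q → 3 * g * q * (4 * (B * R)) ≡ 2 * (6 * g * q * (B * R))
  eq₄ = solve-∀
  eq₅ : ∀ D g n p q → 2 * (8 * g * (16 * D) * p * n + g * q * n + 8 * (16 * D * q) * (n + n)) ≡
        2 * (g * q) * n + n * (512 * D * q + 256 * g * D * p)
  eq₅ = solve-∀
  eq₆ : ∀ D g p q → (512 * D * q + 256 * g * D * p) + (512 * D * q + 256 * g * D * p) ≡ 1024 * D * q + g * (p * (512 * D))
  eq₆ = solve-∀
  eq₇ : ∀ g n q → 2 * (g * q) * n + n * (g * q) ≡ 3 * g * q * n
  eq₇ = solve-∀
  cancelled : 6 * g * q * (B * R) ≤ 8 * g * B * p * n + g * q * n + 8 * (B * q) * (M + R * 2)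
  cancelled = +-cancelˡ-≤ (8 * g * B * (q * n) + 8 * g * B * (q * M)) _ _ (begin
    8 * g * B * (q * n) + 8 * g * B * (q * M) + 6 * g * q * (B * R)
      ≡⟨ eq₃ (8 * g * B * (q * n)) (8 * g * B * (q * M)) (6 * g * q * (B * R)) ⟨
    8 * g * B * (q * n) + (8 * g * B * (q * M) + 6 * g * q * (B * R))
      ≡⟨ cong (λ z → 8 * g * B * (q * n) + z) (eq₁ B M R g q) ⟩
    8 * g * B * (q * n) + q * (g * (2 * B * (4 * M + 3 * R)))
      ≤⟨ +-mono-≤ (*-monoʳ-≤ (8 * g * B) load) (*-monoʳ-≤ q h) ⟩
    8 * g * B * (q * M + p * n) + q * (g * (8 * n * B + n) + 8 * (B * (M + R * 2)))
      ≡⟨ eq₂ B M R g n p q ⟩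
    8 * g * B * (q * n) + 8 * g * B * (q * M) + (8 * g * B * p * n + g * q * n + 8 * (B * q) * (M + R * 2)) ∎)
  ratio : g * q ≤ 512 * D * q + 256 * g * D * p
  ratio = *-cancelˡ-≤ n (+-cancelˡ-≤ (2 * (g * q) * n) _ _ (begin
    2 * (g * q) * n + n * (g * q)    ≡⟨ eq₇ g n q ⟩
    3 * g * q * n                    ≤⟨ *-monoʳ-≤ (3 * g * q) n≤4BR ⟩
    3 * g * q * (4 * (B * R))        ≡⟨ eq₄ B R g q ⟩
    2 * (6 * g * q * (B * R))        ≤⟨ *-monoʳ-≤ 2 cancelled ⟩
    2 * (8 * g * B * p * n + g * q * n + 8 * (B * q) * (M + R * 2))
      ≤⟨ *-monoʳ-≤ 2 (+-monoʳ-≤ (8 * g * B * p * n + g * q * n) (*-monoʳ-≤ (8 * (B * q)) (+-mono-≤ M≤n 2R≤n))) ⟩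
    2 * (8 * g * B * p * n + g * q * n + 8 * (B * q) * (n + n))
      ≡⟨ eq₅ D g n p q ⟩
    2 * (g * q) * n + n * (512 * D * q + 256 * g * D * p) ∎))

module Bounds {n u s f : ℕ} {δ : ℚ} .{{_ : Positive δ}} .{{_ : NonZero f}} .{{_ : NonZero n}}
  (n²≤u : n * n ≤ u) (T : Table n u) (isTable : IsDereferenceTable T δ (+ 1 ℚ./ f)) (sized : FixedSize T δ s) where

  open IsDereferenceTable isTable

  cap : ℚ
  cap = (1ℚ ℚ.- δ) ℚ.* fromℕ n

  cap+δn : cap ℚ.+ δ ℚ.* fromℕ n ≡ fromℕ n
  cap+δn = begin
    (1ℚ ℚ.- δ) ℚ.* fromℕ n ℚ.+ δ ℚ.* fromℕ n  ≡⟨ ℚ.*-distribʳ-+ (fromℕ n) (1ℚ ℚ.- δ) δ ⟨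
    (1ℚ ℚ.- δ ℚ.+ δ) ℚ.* fromℕ n              ≡⟨ cong (ℚ._* fromℕ n) (trans (ℚ.+-assoc 1ℚ (ℚ.- δ) δ) (trans (cong (λ z → 1ℚ ℚ.+ z) (ℚ.+-inverseˡ δ)) (ℚ.+-identityʳ 1ℚ))) ⟩
    1ℚ ℚ.* fromℕ n                            ≡⟨ ℚ.*-identityˡ (fromℕ n) ⟩
    fromℕ n                                   ∎
    where open ≡-Reasoning

  cap≤n : cap ℚ.≤ fromℕ n
  cap≤n = begin
    cap                        ≡⟨ ℚ.+-identityʳ cap ⟨
    cap ℚ.+ 0ℚ                 ≡⟨ cong (λ z → cap ℚ.+ z) (ℚ.*-zeroʳ δ) ⟨
    cap ℚ.+ δ ℚ.* fromℕ 0      ≤⟨ ℚ.+-monoʳ-≤ cap (ℚ.*-monoˡ-≤-nonNeg δ {{ℚ.pos⇒nonNeg δ}} (fromℕ-mono {0} {n} z≤n)) ⟩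
    cap ℚ.+ δ ℚ.* fromℕ n      ≡⟨ cap+δn ⟩
    fromℕ n                    ∎
    where open ℚ.≤-Reasoning

  M : ℕ
  M = proj₁ (find-capacity cap n cap≤n)

  M≤n : M ≤ n
  M≤n = proj₁ (proj₂ (find-capacity cap n cap≤n))

  capacity : ∀ {z} → z < M → fromℕ z ℚ.< cap
  capacity = proj₁ (proj₂ (proj₂ (find-capacity cap n cap≤n)))

  cap≤M : cap ℚ.≤ fromℕ M
  cap≤M = proj₂ (proj₂ (proj₂ (find-capacity cap n cap≤n)))

  p q : ℕ
  p = numerator δ
  q = denominator δ

  load : q * n ≤ q * M + p * n
  load = fromℕ-≤-+-* δ n M n (ℚ.≤-trans (ℚ.≤-reflexive (sym cap+δn)) (ℚ.+-monoˡ-≤ (δ ℚ.* fromℕ n) cap≤M))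

  -- The failure probability and the chance 1/n of picking a key that is
  -- already present are both at most 1/g.
  g : ℕ
  g = f ⊓ n

  gn≤u : g * n ≤ u
  gn≤u = ≤-trans (*-monoˡ-≤ n (m⊓n≤n f n)) n²≤u

  failure′ : ∀ {h k} → Legal n δ (alloc k ∷ h) → ∃[ m ] ∃[ A ]
             (∀ ω → Fails T h k ω → prefix m ω List.∈ A) × g * length A ≤ 2 ^ m
  failure′ ℓ with failure ℓ
  ... | m , A , covers , small = m , A , covers ,
    ≤-trans (*-monoˡ-≤ (length A) (m⊓n≤m f n)) (/-≤-1/ (length A) (2 ^ m) f {{m^n≢0 2 m}} small)

  open Analysis {n} {u} {s} {M} {g} {δ} T distinct failure′ sized capacity using (D; crowding-bound; module Churn)

  suc-D : suc D ≡ 2 ^ suc s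
  suc-D = length-pointers s

  instance
    D≢0 : NonZero D
    D≢0 = ≢-nonZero λ D≡0 → contradiction (trans (sym (cong suc D≡0)) suc-D) (<⇒≢ (^-monoʳ-< 2 (s≤s (s≤s z≤n)) {0} {suc s} (s≤s z≤n)))
    u≢0 : NonZero u
    u≢0 = >-nonZero (≤-trans (>-nonZero⁻¹ (n * n) {{m*n≢0 n n}}) n²≤u)

  -- The phase length is n/(aP) rounded down: P phases then fit into the capacity M ≥ n/a, and
  -- rounding loses at most a factor of two once the length is positive.
  crowding : ∀ a → .{{_ : NonZero a}} → n ≤ a * M → g < (16 * a * suc D * D) ^ (2 ^ suc D)
  crowding a n≤aM = go (n / (a * P)) (m/n*n≤m n (a * P)) (m<n+m/n*n n (a * P))
    where
    open ≤-Reasoning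
    P θ : ℕ
    P = suc D
    θ = 16 * a * P * D
    instance
      aP≢0 : NonZero (a * P)
      aP≢0 = m*n≢0 a P
      16a≢0 : NonZero (16 * a)
      16a≢0 = m*n≢0 16 a
      16aP≢0 : NonZero (16 * a * P)
      16aP≢0 = m*n≢0 (16 * a) P
      θ≢0 : NonZero θ
      θ≢0 = m*n≢0 (16 * a * P) D
      2^P≢0 : NonZero (2 ^ P)
      2^P≢0 = m^n≢0 2 P
    eq₁ : ∀ a d p → a * p * (16 * d) ≡ 16 * a * p * d
    eq₁ = solve-∀
    eq₂ : ∀ a p l → a * (p * l) ≡ l * (a * p)
    eq₂ = solve-∀
    eq₃ : ∀ a p l → l * (a * p) + l * (a * p) ≡ 2 * a * p * l
    eq₃ = solve-∀
    go : ∀ L → L * (a * P) ≤ n → n < a * P + L * (a * P) → g < θ ^ (2 ^ P)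
    -- Too few slots for even one insertion per phase: then n < aP, and the bound is trivial because
    -- g ≤ n.
    go zero    _  above = begin-strict
      g                 ≤⟨ m⊓n≤n f n ⟩
      n                 <⟨ above ⟩
      a * P + 0         ≡⟨ +-identityʳ _ ⟩
      a * P             ≤⟨ m≤m*n (a * P) (16 * D) {{m*n≢0 16 D}} ⟩
      a * P * (16 * D)  ≡⟨ eq₁ a D P ⟩
      θ                 ≡⟨ ^-identityʳ θ ⟨
      θ ^ 1             ≤⟨ ^-monoʳ-≤ θ (>-nonZero⁻¹ (2 ^ P)) ⟩
      θ ^ (2 ^ P)       ∎
    go L@(suc _) below above = crowding-bound M≤n gn≤u a L
      (*-cancelˡ-≤ a (begin
        a * (P * L)     ≡⟨ eq₂ a P L ⟩
        L * (a * P)     ≤⟨ below ⟩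
        n               ≤⟨ n≤aM ⟩
        a * M           ∎))
      (begin
        n                          ≤⟨ <⇒≤ above ⟩
        a * P + L * (a * P)        ≤⟨ +-monoˡ-≤ (L * (a * P)) (m≤n*m (a * P) L) ⟩
        L * (a * P) + L * (a * P)  ≡⟨ eq₃ a P L ⟩
        2 * a * P * L              ∎)

  n≤u : n ≤ u
  n≤u = ≤-trans (m≤m*n n n) n²≤u

  churning : (q ≤ p * 2 ⊎ q ≤ p * (512 * D)) ⊎ g ≤ 1024 * D
  churning with q ≤? p * 2 | n <? 64 * D
  ... | yes half | _        = inj₁ (inj₁ half)
  ... | no  _    | yes few  = inj₂ (≤-trans (m⊓n≤n f n) (≤-trans (<⇒≤ few) (*-monoˡ-≤ D (m≤m+n 64 960))))
  ... | no  half | no  many = map₁ inj₂ (churn-ratio {B} {D} {M} {R} {g} {n} {p} {q}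
    (Churn.churn-bound {B} {R} M≤n gn≤u (≤-trans M≤n n≤u) BR≤M R-small) load refl n≤4BR M≤n 2R≤n)
    where
    open ≤-Reasoning
    B : ℕ
    -- With `R` equal to n/(2B) rounded down, the blocks contain between n/4 and n/2 keys in all. So
    -- the at most n/8 heavy slots are at most half of what is freed, and 32DR ≤ n holds as `refill`
    -- requires.
    B = 16 * D
    instance
      2B≢0 : NonZero (2 * B)
      2B≢0 = m*n≢0 2 B {{_}} {{m*n≢0 16 D}}
      B≢0 : NonZero B
      B≢0 = m*n≢0 16 D
      q≢0 : NonZero q
      q≢0 = >-nonZero (≤-trans (s≤s z≤n) (≰⇒> half))
    R : ℕ
    R = n / (2 * B)
    below : R * (2 * B) ≤ n
    below = m/n*n≤m n (2 * B)
    eq₁ : ∀ d r → 32 * d * r ≡ r * (2 * (16 * d))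
    eq₁ = solve-∀
    R-small : 32 * D * R ≤ n
    R-small = ≤-trans (≤-reflexive (eq₁ D R)) below
    2R≤n : R * 2 ≤ n
    2R≤n = ≤-trans (*-monoʳ-≤ R (m≤m*n 2 B)) below
    eq₂ : ∀ b r → 2 * (b * r) ≡ r * (2 * b)
    eq₂ = solve-∀
    eq₃ : ∀ a b → a * b + a * b ≡ 2 * (a * b)
    eq₃ = solve-∀
    eq₄ : ∀ p n → 2 * (p * n) ≡ p * 2 * n
    eq₄ = solve-∀
    eq₅ : ∀ q m → 2 * (q * m) ≡ q * (2 * m)
    eq₅ = solve-∀
    n≤2M : n ≤ 2 * M
    n≤2M = *-cancelˡ-≤ q (+-cancelʳ-≤ (q * n) _ _ (begin
      q * n + q * n                ≡⟨ eq₃ q n ⟩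
      2 * (q * n)                  ≤⟨ *-monoʳ-≤ 2 load ⟩
      2 * (q * M + p * n)          ≡⟨ *-distribˡ-+ 2 (q * M) (p * n) ⟩
      2 * (q * M) + 2 * (p * n)    ≡⟨ cong₂ _+_ (eq₅ q M) (eq₄ p n) ⟩
      q * (2 * M) + p * 2 * n      ≤⟨ +-monoʳ-≤ (q * (2 * M)) (*-monoˡ-≤ n (<⇒≤ (≰⇒> half))) ⟩
      q * (2 * M) + q * n          ∎))
    BR≤M : B * R ≤ M
    BR≤M = *-cancelˡ-≤ 2 (≤-trans (≤-reflexive (eq₂ B R)) (≤-trans below n≤2M))
    eq₆ : ∀ d r → 2 * (2 * (16 * d) + r * (2 * (16 * d))) ≡ 64 * d + 4 * (16 * d * r)
    eq₆ = solve-∀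
    n≤4BR : n ≤ 4 * (B * R)
    n≤4BR = +-cancelˡ-≤ n _ _ (begin
      n + n                          ≡⟨ cong (λ z → n + z) (+-identityʳ n) ⟨
      2 * n                          ≤⟨ *-monoʳ-≤ 2 (<⇒≤ (m<n+m/n*n n (2 * B))) ⟩
      2 * (2 * B + R * (2 * B))      ≡⟨ eq₆ D R ⟩
      64 * D + 4 * (B * R)           ≤⟨ +-monoˡ-≤ (4 * (B * R)) (≮⇒≥ many) ⟩
      n + 4 * (B * R)                ∎)

⊓-^ : ∀ {n f c} → 2 ≤ n → n ≤ f ^ c → n ≤ (f ⊓ n) ^ c
⊓-^ {n} {f} {zero}  2≤n h = contradiction (≤-trans 2≤n h) λ { (s≤s ()) }
⊓-^ {n} {f} {suc c} 2≤n h with ⊓-sel f n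
... | inj₁ e = subst (λ z → n ≤ z ^ suc c) (sym e) h
... | inj₂ e = subst (λ z → n ≤ z ^ suc c) (sym e) (m≤m*n n (n ^ c) {{m^n≢0 n c {{>-nonZero (≤-trans (s≤s z≤n) 2≤n)}}}})

theorem4 : (α : ℚ) → .{{_ : Positive α}} → (c d : ℕ) →
    ∃[ K ] ∃[ A ] ∃[ N ]
    ((n u s f : ℕ) → .{{_ : NonZero f}} → (δ : ℚ) → .{{_ : Positive δ}} →
    N ≤ n → n ^ K ≤ u →
    α ℚ.≤ 1ℚ ℚ.- δ → 1ℚ ℚ.≤ δ ℚ.* fromℕ (n ^ d) → n ≤ f ^ c →
    (T : Table n u) → IsDereferenceTable T δ (+ 1 ℚ./ f) → FixedSize T δ s →
    ⌈log₂ ⌈log₂ ⌈log₂ n ⌉ ⌉ ⌉ + log₂⌈1/ δ ⌉ ≤ A * s)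
theorem4 α c d = 2 , a + c + 9 + 12 * (1 + c * d) , N , λ n u s f δ N≤n n²≤u α≤1-δ 1≤δnᵈ n≤fᶜ T isTable sized →
  let
    2≤n : 2 ≤ n
    2≤n = ≤-trans (m≤m+n 2 _) N≤n
    n≢0 : NonZero n
    n≢0 = >-nonZero (≤-trans (s≤s z≤n) 2≤n)
  in conclude n {{n≢0}} u s f δ 2≤n N≤n (subst (λ z → n * z ≤ u) (*-identityʳ n) n²≤u) α≤1-δ 1≤δnᵈ n≤fᶜ T isTable sized
  where
  a : ℕ
  -- α is at least `1 / a`, so the load factor bound gives n ≤ aM.
  a = denominator α
  exponent : ℕ → ℕ
  -- θ is at most 2^(a+2s+6), the exponent 2^P is 2^(2^(s+1)), and the power `c` passes from `g` to
  -- n.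
  exponent s = (a + (s + s) + 6) * 2 ^ (2 ^ suc s) * c
  N : ℕ
  -- Large enough to contradict n ≤ 2^`exponent 0`, which excludes s = 0; only with s ≥ 1 can
  -- additive constants be absorbed into a multiple of s.
  N = 2 + 2 ^ exponent 0

  open ≤-Reasoning

  triple-log : ∀ s → ⌈log₂ ⌈log₂ exponent s ⌉ ⌉ ≤ a + c + s + 8
  triple-log s = ⌈log₂⌉-≤ (≤-trans (⌈log₂⌉-≤ inner) outer)
    where
    w : ℕ
    w = a + (s + s) + 6
    inner : exponent s ≤ 2 ^ (w + 2 ^ suc s + c)
    inner = begin
      w * 2 ^ (2 ^ suc s) * c              ≤⟨ *-mono-≤ (*-monoˡ-≤ (2 ^ (2 ^ suc s)) (n≤2^n w)) (n≤2^n c) ⟩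
      2 ^ w * 2 ^ (2 ^ suc s) * 2 ^ c      ≡⟨ cong (_* 2 ^ c) (^-distribˡ-+-* 2 w (2 ^ suc s)) ⟨
      2 ^ (w + 2 ^ suc s) * 2 ^ c          ≡⟨ ^-distribˡ-+-* 2 (w + 2 ^ suc s) c ⟨
      2 ^ (w + 2 ^ suc s + c)              ∎
    x : ℕ
    x = 2 ^ (a + c + s + 6)
    eq₁ : ∀ a s c z → a + (s + s) + 6 + z + c ≡ a + c + s + 6 + s + z
    eq₁ = solve-∀
    eq₂ : ∀ x → x + x + (x + x) ≡ x * 4
    eq₂ = solve-∀
    outer : w + 2 ^ suc s + c ≤ 2 ^ (a + c + s + 8)
    outer = begin
      w + 2 ^ suc s + c                            ≡⟨ eq₁ a s c (2 ^ suc s) ⟩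
      a + c + s + 6 + s + 2 ^ suc s                ≤⟨ +-mono-≤ (+-mono-≤ (n≤2^n (a + c + s + 6)) s≤x) 2^≤x+x ⟩
      x + x + (x + x)                              ≡⟨ eq₂ x ⟩
      x * 2 ^ 2                                    ≡⟨ ^-distribˡ-+-* 2 (a + c + s + 6) 2 ⟨
      2 ^ (a + c + s + 6 + 2)                      ≡⟨ cong (2 ^_) (+-assoc (a + c + s) 6 2) ⟩
      2 ^ (a + c + s + 8)                          ∎
      where
      s≤ : s ≤ a + c + s + 6
      s≤ = ≤-trans (m≤n+m s (a + c)) (m≤m+n (a + c + s) 6)
      s≤x : s ≤ x
      s≤x = ≤-trans s≤ (n≤2^n (a + c + s + 6))
      2^≤x+x : 2 ^ suc s ≤ x + x
      2^≤x+x = ≤-trans (*-monoʳ-≤ 2 (^-monoʳ-≤ 2 s≤)) (≤-reflexive (cong (λ z → x + z) (+-identityʳ x)))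

  conclude : ∀ n → .{{_ : NonZero n}} → ∀ u s f → .{{_ : NonZero f}} → (δ : ℚ) → .{{_ : Positive δ}} → 2 ≤ n →
    N ≤ n → n * n ≤ u → α ℚ.≤ 1ℚ ℚ.- δ → 1ℚ ℚ.≤ δ ℚ.* fromℕ (n ^ d) → n ≤ f ^ c →
    (T : Table n u) → IsDereferenceTable T δ (+ 1 ℚ./ f) → FixedSize T δ s →
    ⌈log₂ ⌈log₂ ⌈log₂ n ⌉ ⌉ ⌉ + log₂⌈1/ δ ⌉ ≤ (a + c + 9 + 12 * (1 + c * d)) * s
  conclude n u s f δ 2≤n N≤n n²≤u α≤1-δ 1≤δnᵈ n≤fᶜ T isTable sized = begin
    ⌈log₂ ⌈log₂ ⌈log₂ n ⌉ ⌉ ⌉ + log₂⌈1/ δ ⌉        ≤⟨ +-mono-≤ logloglog log-δ ⟩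
    a + c + s + 8 + (s + 11) * (1 + c * d)         ≤⟨ linear (a + c) (c * d) s≥1 ⟩
    (a + c + 9 + 12 * (1 + c * d)) * s             ∎
    where
    open Bounds {n} {u} {s} {f} {δ} n²≤u T isTable sized
    D : ℕ
    D = length (pointers s)
    n≤gᶜ : n ≤ g ^ c
    n≤gᶜ = ⊓-^ {n} {f} {c} 2≤n n≤fᶜ
    D≤ : D ≤ 2 ^ suc s
    D≤ = ≤-trans (n≤1+n D) (≤-reflexive suc-D)
    n≤aM : n ≤ a * M
    n≤aM = ≤-trans (m≤n*m n (numerator α) {{positive-numerator α}}) (*-fromℕ-≤ α n M
      (ℚ.≤-trans (ℚ.*-monoʳ-≤-nonNeg (fromℕ n) {{fromℕ-nonNeg n}} α≤1-δ) cap≤M))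
    n≤2^exponent : n ≤ 2 ^ exponent s
    n≤2^exponent = begin
      n                                       ≤⟨ n≤gᶜ ⟩
      g ^ c                                   ≤⟨ ^-monoˡ-≤ c (<⇒≤ (crowding a n≤aM)) ⟩
      ((16 * a * suc D * D) ^ (2 ^ suc D)) ^ c ≤⟨ ^-monoˡ-≤ c (^-monoˡ-≤ (2 ^ suc D) θ≤) ⟩
      ((2 ^ (a + (s + s) + 6)) ^ (2 ^ suc D)) ^ c ≡⟨ trans (cong (_^ c) (^-*-assoc 2 (a + (s + s) + 6) (2 ^ suc D))) (^-*-assoc 2 ((a + (s + s) + 6) * 2 ^ suc D) c) ⟩
      2 ^ ((a + (s + s) + 6) * 2 ^ suc D * c) ≡⟨ cong (λ z → 2 ^ ((a + (s + s) + 6) * 2 ^ z * c)) suc-D ⟩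
      2 ^ exponent s                          ∎
      where
      θ≤ : 16 * a * suc D * D ≤ 2 ^ (a + (s + s) + 6)
      θ≤ = begin
        16 * a * suc D * D                       ≤⟨ *-mono-≤ (*-mono-≤ (*-monoʳ-≤ 16 (n≤2^n a)) (≤-reflexive suc-D)) D≤ ⟩
        16 * 2 ^ a * 2 ^ suc s * 2 ^ suc s       ≡⟨ cong (λ z → z * 2 ^ suc s * 2 ^ suc s) (^-distribˡ-+-* 2 4 a) ⟨
        2 ^ (4 + a) * 2 ^ suc s * 2 ^ suc s      ≡⟨ cong (_* 2 ^ suc s) (^-distribˡ-+-* 2 (4 + a) (suc s)) ⟨
        2 ^ (4 + a + suc s) * 2 ^ suc s          ≡⟨ ^-distribˡ-+-* 2 (4 + a + suc s) (suc s) ⟨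
        2 ^ (4 + a + suc s + suc s)              ≡⟨ cong (2 ^_) (eq a s) ⟩
        2 ^ (a + (s + s) + 6)                    ∎
        where
        eq : ∀ a s → 4 + a + (1 + s) + (1 + s) ≡ a + (s + s) + 6
        eq = solve-∀
    logloglog : ⌈log₂ ⌈log₂ ⌈log₂ n ⌉ ⌉ ⌉ ≤ a + c + s + 8
    logloglog = ≤-trans (⌈log₂⌉-mono-≤ (⌈log₂⌉-mono-≤ (⌈log₂⌉-≤ {n} {exponent s} n≤2^exponent))) (triple-log s)
    s≥1 : 1 ≤ s
    s≥1 = n≢0⇒n>0 λ s≡0 → contradiction (≤-trans (≤-trans (n≤1+n _) N≤n) (subst (λ z → n ≤ 2 ^ exponent z) s≡0 n≤2^exponent)) 1+n≰n
    q≤pnᵈ : q ≤ p * n ^ d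
    q≤pnᵈ = ≤-trans (≤-reflexive (sym (*-identityʳ q))) (≤-trans
      (fromℕ-≤-+-* δ 1 0 (n ^ d) (ℚ.≤-trans 1≤δnᵈ (ℚ.≤-reflexive (sym (ℚ.+-identityˡ _)))))
      (≤-reflexive (cong (_+ p * n ^ d) (*-zeroʳ q))))
    log-δ : log₂⌈1/ δ ⌉ ≤ (s + 11) * (1 + c * d)
    log-δ with churning
    ... | inj₁ (inj₁ q≤2p) = log₂⌈1/⌉-≤ δ {2} {(s + 11) * (1 + c * d)} q≤2p
      (^-monoʳ-≤ 2 {1} (*-mono-≤ {1} {s + 11} {1} (≤-trans (m≤m+n 1 10) (m≤n+m 11 s)) (s≤s z≤n)))
    ... | inj₁ (inj₂ q≤512Dp) = log₂⌈1/⌉-≤ δ {512 * D} {(s + 11) * (1 + c * d)} q≤512Dp (begin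
      512 * D                        ≤⟨ *-monoʳ-≤ 512 D≤ ⟩
      2 ^ 9 * 2 ^ suc s              ≡⟨ ^-distribˡ-+-* 2 9 (suc s) ⟨
      2 ^ (9 + suc s)                ≤⟨ ^-monoʳ-≤ 2 (≤-trans (≤-trans (n≤1+n _) (≤-reflexive (eq s))) (m≤m*n (s + 11) (1 + c * d))) ⟩
      2 ^ ((s + 11) * (1 + c * d))   ∎)
      where
      eq : ∀ s → 1 + (9 + (1 + s)) ≡ s + 11
      eq = solve-∀
    -- Failures are too frequent for churning to help, but n ≤ g^c is then at most 2^((s+11)c), and
    -- 1/δ is at most n^d.
    ... | inj₂ g≤1024D = log₂⌈1/⌉-≤ δ {n ^ d} {(s + 11) * (1 + c * d)} q≤pnᵈ (begin
      n ^ d                          ≤⟨ ^-monoˡ-≤ d (≤-trans n≤gᶜ (^-monoˡ-≤ c g≤)) ⟩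
      ((2 ^ (s + 11)) ^ c) ^ d       ≡⟨ trans (^-*-assoc (2 ^ (s + 11)) c d) (^-*-assoc 2 (s + 11) (c * d)) ⟩
      2 ^ ((s + 11) * (c * d))       ≤⟨ ^-monoʳ-≤ 2 (*-monoʳ-≤ (s + 11) (n≤1+n (c * d))) ⟩
      2 ^ ((s + 11) * (1 + c * d))   ∎)
      where
      eq : ∀ s → 10 + (1 + s) ≡ s + 11
      eq = solve-∀
      g≤ : g ≤ 2 ^ (s + 11)
      g≤ = begin
        g                    ≤⟨ g≤1024D ⟩
        1024 * D             ≤⟨ *-monoʳ-≤ 1024 D≤ ⟩
        2 ^ 10 * 2 ^ suc s   ≡⟨ ^-distribˡ-+-* 2 10 (suc s) ⟨
        2 ^ (10 + suc s)     ≡⟨ cong (2 ^_) (eq s) ⟩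
        2 ^ (s + 11)         ∎
    linear : ∀ x y {s} → 1 ≤ s → x + s + 8 + (s + 11) * (1 + y) ≤ (x + 9 + 12 * (1 + y)) * s
    linear x y {suc s} _ = ≤-trans (m≤m+n _ (x * s + 8 * s + 11 * s * (1 + y))) (≤-reflexive (eq x y s))
      where
      eq : ∀ x y s → x + (1 + s) + 8 + ((1 + s) + 11) * (1 + y) + (x * s + 8 * s + 11 * s * (1 + y)) ≡ (x + 9 + 12 * (1 + y)) * (1 + s)
      eq = solve-∀
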